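{- Let $S=(\mathcal S,\mathcal A,\mathcal R)$ be a functional PTS specification, let $\Gamma$ be a context of $\lambda S$ and let $A$ be a $\Gamma$-type of $\lambda S$. If there is a term $N$ such that $\|\Gamma\| \vdash_{\lambda\Pi/S} N : \|A\|_{\Gamma}$, then there is a term $M$ such that $\Gamma \vdash_{\lambda S} M : A$.
   Context: Pure type systems. A PTS specification is $S=(\mathcal S,\mathcal A,\mathcal R)$ with $\mathcal S$ a set of sorts, $\mathcal A\subseteq\mathcal S\times\mathcal S$ a set of axioms written $(s_1:s_2)$, and $\mathcal R\subseteq \mathcal S\times\mathcal S\times\mathcal S$ a set of rules; $(s_1,s_2)$ abbreviates $(s_1,s_2,s_2)$. $S$ is functional if $(s_1:s_2),(s_1:s_2')\in\mathcal A$ imply $s_2=s_2'$ and $(s_1,s_2,s_3),(s_1,s_2,s_3')\in\mathcal R$ imply $s_3=s_3'$. Terms are $T::= s\mid x\mid T\,T\mid \lambda x:T.\,T\mid \Pi x:T.\,T$ ($s$ a sort, $x$ a variable); contexts are lists $x_1:A_1,\dots,x_n:A_n$; $A\to B$ denotes $\Pi x:A.B$ with $x$ not free in $B$. The typing rules of $\lambda S$ (judgments $\mathrm{WF}(\Gamma)$ and $\Gamma\vdash M:A$) are: $\mathrm{WF}(\cdot)$; if $\Gamma\vdash A:s$ and $x\notin\Gamma$ then $\mathrm{WF}(\Gamma,x:A)$; if $\mathrm{WF}(\Gamma)$ and $(x:A)\in\Gamma$ then $\Gamma\vdash x:A$; if $\mathrm{WF}(\Gamma)$ and $(s_1:s_2)\in\mathcal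 A$ then $\Gamma\vdash s_1:s_2$; if $\Gamma\vdash A:s_1$, $\Gamma,x:A\vdash B:s_2$ and $(s_1,s_2,s_3)\in\mathcal R$ then $\Gamma\vdash \Pi x:A.B:s_3$; if $\Gamma,x:A\vdash M:B$ and $\Gamma\vdash\Pi x:A.B:s$ then $\Gamma\vdash\lambda x:A.M:\Pi x:A.B$; if $\Gamma\vdash M:\Pi x:A.B$ and $\Gamma\vdash N:A$ then $\Gamma\vdash M\,N:B[N/x]$; if $\Gamma\vdash M:A$, $\Gamma\vdash B:s$ and $A\equiv_\beta B$ then $\Gamma\vdash M:B$. A $\Gamma$-term is an $M$ with $\mathrm{WF}(\Gamma)$ and $\Gamma\vdash M:A$ for some $A$; a $\Gamma$-type is an $A$ with $\mathrm{WF}(\Gamma)$ and either $\Gamma\vdash A:s$ or $A=s$ for some sort $s$. The $\lambda\Pi$ calculus modulo rewriting. $\lambda\Pi$ is the PTS with sorts $\mathsf{Type},\mathsf{Kind}$, axiom $\mathsf{Type}:\mathsf{Kind}$ and rules $(\mathsf{Type},\mathsf{Type}),(\mathsf{Type},\mathsf{Kind})$. Given a well-formed $\lambda\Pi$ context $\Sigma$ and a set $R$ of rewrite rules $[\Delta]\,M\leadsto N$, $\longrightarrow_R$ is the contextual closure of $\sigma(M)\longrightarrow_R\sigma(N)$ for substitutions $\sigma$ of the variables of $\Delta$, $\longrightarrow_{\beta R}=\longrightarrow_\beta\cup\longrightarrow_R$, and $\equiv_{\beta R}$ is the generated congruence. $\lambda\Pi/(\Sigma,R)$ has the typing rules of $\lambda\Pi$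 except that declarations require $x\notin\Sigma,\Gamma$, the variable rule allows $(x:A)\in\Sigma,\Gamma$, and conversion uses $\equiv_{\beta R}$ instead of $\equiv_\beta$. The system $\lambda\Pi/S$ is $\lambda\Pi/(\Sigma_S,R_S)$ where $\Sigma_S$ declares: $u_s:\mathsf{Type}$ and $\varepsilon_s:u_s\to\mathsf{Type}$ for each $s\in\mathcal S$; $\dot s_1:u_{s_2}$ for each $(s_1:s_2)\in\mathcal A$; $\dot\pi_{s_1s_2s_3}:\Pi\alpha:u_{s_1}.\,(\varepsilon_{s_1}\alpha\to u_{s_2})\to u_{s_3}$ for each $(s_1,s_2,s_3)\in\mathcal R$; and $R_S$ contains $\varepsilon_{s_2}\,\dot s_1\leadsto u_{s_1}$ for $(s_1:s_2)\in\mathcal A$ and $[A:u_{s_1},B:\varepsilon_{s_1}A\to u_{s_2}]\ \varepsilon_{s_3}(\dot\pi_{s_1s_2s_3}\,A\,B)\leadsto \Pi x:\varepsilon_{s_1}A.\,\varepsilon_{s_2}(B\,x)$ for $(s_1,s_2,s_3)\in\mathcal R$. Translation. For $\Gamma$-terms and $\Gamma$-types of $\lambda S$: $|s|_\Gamma=\dot s$, $|x|_\Gamma=x$, $|M\,N|_\Gamma=|M|_\Gamma\,|N|_\Gamma$, $|\lambda x:A.M|_\Gamma=\lambda x:\|A\|_\Gamma.\,|M|_{\Gamma,x:A}$, $|\Pi x:A.B|_\Gamma=\dot\pi_{s_1s_2s_3}\,|A|_\Gamma\,(\lambda x:\|A\|_\Gamma.\,|B|_{\Gamma,x:A})$ where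 $\Gamma\vdash A:s_1$, $\Gamma,x:A\vdash B:s_2$, $(s_1,s_2,s_3)\in\mathcal R$; $\|s\|_\Gamma=u_s$, $\|\Pi x:A.B\|_\Gamma=\Pi x:\|A\|_\Gamma.\,\|B\|_{\Gamma,x:A}$, and otherwise $\|A\|_\Gamma=\varepsilon_s\,|A|_\Gamma$ where $\Gamma\vdash A:s$ (well defined up to $\equiv_{\beta R}$). Contexts: $\|\cdot\|=\cdot$, $\|\Gamma,x:A\|=\|\Gamma\|,x:\|A\|_\Gamma$. -}

module Defs where

open import Data.Empty using (⊥)
open import Data.Fin.Base using (Fin; zero; suc)
open import Data.Fin.Substitution using (Sub; Lift; TermSubst)
open import Data.Nat.Base using (ℕ; zero; suc)
open import Data.Product.Base using (∃-syntax; _×_; _,_)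
open import Data.Sum.Base using (_⊎_; inj₁; inj₂)
open import Data.Vec.Base using ([]; lookup)
open import Level using (0ℓ)
open import Relation.Binary.Construct.Closure.Equivalence using (EqClosure)
open import Relation.Binary.Construct.Union using (_∪_)
open import Relation.Binary.Core using (Rel)
open import Relation.Binary.PropositionalEquality.Core using (_≡_; refl)
open import Relation.Nullary.Negation.Core using (¬_)

------------------------------------------------------------------------
-- Specifications

record Spec : Set₁ where
  field
    Sort  : Set
    Axiom : Sort → Sort → Set
    Rule  : Sort → Sort → Sort → Set

record Functional (S : Spec) : Set where
  open Spec S
  field
    axiom-functional : ∀ {s₁ s₂ s₂′} → Axiom s₁ s₂ → Axiom s₁ s₂′ → s₂ ≡ s₂′
    rule-functional  : ∀ {s₁ s₂ s₃ s₃′} →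
                       Rule s₁ s₂ s₃ → Rule s₁ s₂ s₃′ → s₃ ≡ s₃′

------------------------------------------------------------------------
-- Terms

-- Well-scoped de Bruijn terms. The variables declared in a signature Σ are
-- never bound or substituted for, so they are represented by constants; the
-- terms of a plain PTS are those over the empty set of constants. The side
-- conditions on the freshness of variables are then automatic.

module Syntax (Sort Const : Set) where

  infixl 9 _·_
  infixr 8 _⇒_
  infixl 5 _▹_
  infix  10 _[_]

  data Term (n : ℕ) : Set where
    sort  : Sort → Term n
    var   : Fin n → Term n
    const : Const → Term n
    _·_   : Term n → Term n → Term n
    ƛ     : Term n → Term (suc n) → Term n
    Π     : Term n → Term (suc n) → Term n

  module Apply {T : ℕ → Set} (l : Lift T Term) where
    open Lift l using (_↑; lift)

    infixl 8 _/_

    _/_ : ∀ {m n} → Term m → Sub T m n → Term n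
    sort s  / ρ = sort s
    var x   / ρ = lift (lookup ρ x)
    const c / ρ = const c
    (M · N) / ρ = (M / ρ) · (N / ρ)
    ƛ A M   / ρ = ƛ (A / ρ) (M / ρ ↑)
    Π A B   / ρ = Π (A / ρ) (B / ρ ↑)

  termSubst : TermSubst Term
  termSubst = record { var = var ; app = Apply._/_ }

  open TermSubst termSubst public using (_/_; weaken; sub)

  _[_] : ∀ {n} → Term (suc n) → Term n → Term n
  M [ N ] = M / sub N

  _⇒_ : ∀ {n} → Term n → Term n → Term n
  A ⇒ B = Π A (weaken B)

  data Ctx : ℕ → Set where
    ∙   : Ctx zero
    _▹_ : ∀ {n} → Ctx n → Term n → Ctx (suc n)

  typeOf : ∀ {n} → Ctx n → Fin n → Term n
  typeOf (Γ ▹ A) zero    = weaken A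
  typeOf (Γ ▹ A) (suc x) = weaken (typeOf Γ x)

-- A signature Σ together with a set R of rewrite rules [Δ] M ⇝ N.

record Theory (Sort : Set) : Set₁ where
  field
    Const : Set
  open Syntax Sort Const
  field
    Declares : Const → Term 0 → Set
    Rewrites : ∀ {k} → Ctx k → Term k → Term k → Set

∅ : ∀ {Sort} → Theory Sort
∅ = record { Const = ⊥ ; Declares = λ _ _ → ⊥ ; Rewrites = λ _ _ _ → ⊥ }

------------------------------------------------------------------------
-- Pure type systems modulo a theory (Σ, R)

module PTSModulo (S : Spec) (T : Theory (Spec.Sort S)) where
  open Spec S public
  open Theory T public
  open Syntax Sort Const public

  infix 4 _⟶_ _≈_ _⊢_∶_

  data βStep {n} : Rel (Term n) 0ℓ where
    β : ∀ {A M N} → βStep (ƛ A M · N) (M [ N ])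

  data RStep {n} : Rel (Term n) 0ℓ where
    rewrite-by : ∀ {k} {Δ : Ctx k} {M N} → Rewrites Δ M N →
                 (σ : Sub Term k n) → RStep (M / σ) (N / σ)

  data Contextual (Step : ∀ {n} → Rel (Term n) 0ℓ) {n} : Rel (Term n) 0ℓ where
    step : ∀ {M M′} → Step M M′ → Contextual Step M M′
    ·ˡ   : ∀ {M M′ N} → Contextual Step M M′ → Contextual Step (M · N) (M′ · N)
    ·ʳ   : ∀ {M N N′} → Contextual Step N N′ → Contextual Step (M · N) (M · N′)
    ƛˡ   : ∀ {A A′ M} → Contextual Step A A′ → Contextual Step (ƛ A M) (ƛ A′ M)
    ƛʳ   : ∀ {A M M′} → Contextual Step M M′ → Contextual Step (ƛ A M) (ƛ A M′)
    Πˡ   : ∀ {A A′ B} → Contextual Step A A′ → Contextual Step (Π A B) (Π A′ B)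
    Πʳ   : ∀ {A B B′} → Contextual Step B B′ → Contextual Step (Π A B) (Π A B′)

  _⟶_ : ∀ {n} → Rel (Term n) 0ℓ
  _⟶_ = Contextual βStep ∪ Contextual RStep

  _≈_ : ∀ {n} → Rel (Term n) 0ℓ
  _≈_ = EqClosure _⟶_

  data WF : ∀ {n} → Ctx n → Set
  data _⊢_∶_ {n} (Γ : Ctx n) : Term n → Term n → Set

  data WF where
    empty  : WF ∙
    extend : ∀ {n} {Γ : Ctx n} {A s} → Γ ⊢ A ∶ sort s → WF (Γ ▹ A)

  data _⊢_∶_ {n} Γ where
    ⊢var   : ∀ x → WF Γ → Γ ⊢ var x ∶ typeOf Γ x
    -- Substituting [] weakens the closed type A to the scope of Γ.
    ⊢const : ∀ {c A} → WF Γ → Declares c A → Γ ⊢ const c ∶ A / []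
    ⊢sort  : ∀ {s₁ s₂} → WF Γ → Axiom s₁ s₂ → Γ ⊢ sort s₁ ∶ sort s₂
    ⊢Π     : ∀ {A B s₁ s₂ s₃} → Γ ⊢ A ∶ sort s₁ → Γ ▹ A ⊢ B ∶ sort s₂ →
             Rule s₁ s₂ s₃ → Γ ⊢ Π A B ∶ sort s₃
    ⊢ƛ     : ∀ {A B M s} → Γ ▹ A ⊢ M ∶ B → Γ ⊢ Π A B ∶ sort s →
             Γ ⊢ ƛ A M ∶ Π A B
    ⊢·     : ∀ {A B M N} → Γ ⊢ M ∶ Π A B → Γ ⊢ N ∶ A → Γ ⊢ M · N ∶ B [ N ]
    ⊢conv  : ∀ {A B M s} → Γ ⊢ M ∶ A → Γ ⊢ B ∶ sort s → A ≈ B → Γ ⊢ M ∶ B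

  IsType : ∀ {n} → Ctx n → Term n → Set
  IsType Γ A = WF Γ × ((∃[ s ] Γ ⊢ A ∶ sort s) ⊎ (∃[ s ] A ≡ sort s))

-- λS has no constants and no rewrite rules, so _≈_ is β-conversion.

module λS (S : Spec) = PTSModulo S ∅

------------------------------------------------------------------------
-- The systems λΠ and λΠ/S

data λΠ-Sort : Set where
  Type Kind : λΠ-Sort

data λΠ-Axiom : λΠ-Sort → λΠ-Sort → Set where
  Type∶Kind : λΠ-Axiom Type Kind

data λΠ-Rule : λΠ-Sort → λΠ-Sort → λΠ-Sort → Set where
  Type,Type : λΠ-Rule Type Type Type
  Type,Kind : λΠ-Rule Type Kind Kind

λΠ : Spec
λΠ = record { Sort = λΠ-Sort ; Axiom = λΠ-Axiom ; Rule = λΠ-Rule }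

module Encoding (S : Spec) where
  open Spec S

  -- Constants are names only; the names dot s and pi s₁ s₂ s₃ are declared
  -- just when S has a corresponding axiom or rule.

  data Const : Set where
    u   : Sort → Const
    ε   : Sort → Const
    dot : Sort → Const
    pi  : Sort → Sort → Sort → Const

  open Syntax λΠ-Sort Const

  data Declares : Const → Term 0 → Set where
    u   : ∀ s → Declares (u s) (sort Type)
    ε   : ∀ s → Declares (ε s) (const (u s) ⇒ sort Type)
    dot : ∀ {s₁ s₂} → Axiom s₁ s₂ → Declares (dot s₁) (const (u s₂))
    pi  : ∀ {s₁ s₂ s₃} → Rule s₁ s₂ s₃ →
          Declares (pi s₁ s₂ s₃)
            (Π (const (u s₁))
               (((const (ε s₁) · var zero) ⇒ const (u s₂)) ⇒ const (u s₃)))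

  -- In the context ∙ ▹ A ▹ B the variable A is var (suc zero) and B is
  -- var zero; under the binder Π x both are shifted by one.

  data Rewrites : ∀ {k} → Ctx k → Term k → Term k → Set where
    ε-dot : ∀ {s₁ s₂} → Axiom s₁ s₂ →
            Rewrites ∙ (const (ε s₂) · const (dot s₁)) (const (u s₁))
    ε-pi  : ∀ {s₁ s₂ s₃} → Rule s₁ s₂ s₃ →
            Rewrites
              (∙ ▹ const (u s₁) ▹ ((const (ε s₁) · var zero) ⇒ const (u s₂)))
              (const (ε s₃) ·
                (const (pi s₁ s₂ s₃) · var (suc zero) · var zero))
              (Π (const (ε s₁) · var (suc zero))
                 (const (ε s₂) · (var (suc zero) · var zero)))

  theory : Theory λΠ-Sort
  theory = record
    { Const = Const ; Declares = Declares ; Rewrites = Rewrites }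

module λΠ/S (S : Spec) where
  open PTSModulo λΠ (Encoding.theory S) public
  open Encoding S public using (u; ε; dot; pi)

------------------------------------------------------------------------
-- The translation of λS into λΠ/S

-- The translation depends on the sorts of types, and these are not computable
-- from raw terms, so it is given by its graph:
--   Γ ⊢∣ M ∣≔ M′  means that M′ is a value of |M|_Γ,
--   Γ ⊢‖ A ‖≔ A′  means that A′ is a value of ‖A‖_Γ,
--   ‖ Γ ‖≔ Γ′     means that Γ′ is a value of ‖Γ‖.
-- Values are shown to exist by the functions term-value, type-value and
-- ctx-value below.

module Translation (S : Spec) where
  open λS S
  private module P = λΠ/S S
  open P using (u; ε; dot; pi)

  infix 4 _⊢∣_∣≔_ _⊢‖_‖≔_ ‖_‖≔_

  data SortOrΠ {n} : Term n → Set where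
    sort : ∀ s → SortOrΠ (sort s)
    Π    : ∀ A B → SortOrΠ (Π A B)

  data _⊢∣_∣≔_ {n} (Γ : Ctx n) : Term n → P.Term n → Set
  data _⊢‖_‖≔_ {n} (Γ : Ctx n) : Term n → P.Term n → Set

  data _⊢∣_∣≔_ {n} Γ where
    sort : ∀ s → Γ ⊢∣ sort s ∣≔ P.const (dot s)
    var  : ∀ x → Γ ⊢∣ var x ∣≔ P.var x
    app  : ∀ {M N M′ N′} → Γ ⊢∣ M ∣≔ M′ → Γ ⊢∣ N ∣≔ N′ →
           Γ ⊢∣ M · N ∣≔ M′ P.· N′
    ƛ    : ∀ {A M A′ M′} → Γ ⊢‖ A ‖≔ A′ → Γ ▹ A ⊢∣ M ∣≔ M′ →
           Γ ⊢∣ ƛ A M ∣≔ P.ƛ A′ M′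
    Π    : ∀ {A B s₁ s₂ s₃ A₁ A₂ B₁} →
           Γ ⊢ A ∶ sort s₁ → Γ ▹ A ⊢ B ∶ sort s₂ → Rule s₁ s₂ s₃ →
           Γ ⊢∣ A ∣≔ A₁ → Γ ⊢‖ A ‖≔ A₂ → Γ ▹ A ⊢∣ B ∣≔ B₁ →
           Γ ⊢∣ Π A B ∣≔ P.const (pi s₁ s₂ s₃) P.· A₁ P.· P.ƛ A₂ B₁

  data _⊢‖_‖≔_ {n} Γ where
    sort  : ∀ s → Γ ⊢‖ sort s ‖≔ P.const (u s)
    Π     : ∀ {A B A′ B′} → Γ ⊢‖ A ‖≔ A′ → Γ ▹ A ⊢‖ B ‖≔ B′ →
            Γ ⊢‖ Π A B ‖≔ P.Π A′ B′
    other : ∀ {A s A′} → ¬ SortOrΠ A → Γ ⊢ A ∶ sort s → Γ ⊢∣ A ∣≔ A′ →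
            Γ ⊢‖ A ‖≔ P.const (ε s) P.· A′

  data ‖_‖≔_ : ∀ {n} → Ctx n → P.Ctx n → Set where
    empty  : ‖ ∙ ‖≔ P.∙
    extend : ∀ {n} {Γ : Ctx n} {A Γ′ A′} → ‖ Γ ‖≔ Γ′ → Γ ⊢‖ A ‖≔ A′ →
             ‖ Γ ▹ A ‖≔ (Γ′ P.▹ A′)

  mutual
    term-value : ∀ {n} {Γ : Ctx n} {M A} → Γ ⊢ M ∶ A → ∃[ M′ ] Γ ⊢∣ M ∣≔ M′
    term-value (⊢var x _)      = _ , var x
    term-value (⊢sort _ _)     = _ , sort _
    term-value (⊢Π ⊢A ⊢B r)    =
      let _ , a = term-value ⊢A ; _ , a′ = type-value′ ⊢A ; _ , b = term-value ⊢B
      in  _ , Π ⊢A ⊢B r a a′ b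
    term-value (⊢ƛ ⊢M ⊢ΠAB)    =
      let (_ , a) , _ = Π-values ⊢ΠAB ; _ , m = term-value ⊢M in _ , ƛ a m
    term-value (⊢· ⊢M ⊢N)      =
      let _ , m = term-value ⊢M ; _ , n = term-value ⊢N in _ , app m n
    term-value (⊢conv ⊢M _ _)  = term-value ⊢M

    type-value′ : ∀ {n} {Γ : Ctx n} {A s} →
                  Γ ⊢ A ∶ sort s → ∃[ A′ ] Γ ⊢‖ A ‖≔ A′
    type-value′ {A = sort s}  _  = _ , sort s
    type-value′ {A = Π _ _}   ⊢A =
      let (_ , a) , (_ , b) = Π-values ⊢A in _ , Π a b
    type-value′ {A = var _}   ⊢A = let _ , a = term-value ⊢A in _ , other (λ ()) ⊢A a
    type-value′ {A = _ · _}   ⊢A = let _ , a = term-value ⊢A in _ , other (λ ()) ⊢A a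
    type-value′ {A = ƛ _ _}   ⊢A = let _ , a = term-value ⊢A in _ , other (λ ()) ⊢A a

    Π-values : ∀ {n} {Γ : Ctx n} {A B C} → Γ ⊢ Π A B ∶ C →
               (∃[ A′ ] Γ ⊢‖ A ‖≔ A′) × (∃[ B′ ] Γ ▹ A ⊢‖ B ‖≔ B′)
    Π-values (⊢Π ⊢A ⊢B _)   = type-value′ ⊢A , type-value′ ⊢B
    Π-values (⊢conv ⊢M _ _) = Π-values ⊢M

  type-value : ∀ {n} {Γ : Ctx n} {A} → IsType Γ A → ∃[ A′ ] Γ ⊢‖ A ‖≔ A′
  type-value (_ , inj₁ (_ , ⊢A))   = type-value′ ⊢A
  type-value (_ , inj₂ (s , refl)) = _ , sort s

  typed⇒WF : ∀ {n} {Γ : Ctx n} {M A} → Γ ⊢ M ∶ A → WF Γ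
  typed⇒WF (⊢var _ wf)     = wf
  typed⇒WF (⊢sort wf _)    = wf
  typed⇒WF (⊢Π ⊢A _ _)     = typed⇒WF ⊢A
  typed⇒WF (⊢ƛ _ ⊢ΠAB)     = typed⇒WF ⊢ΠAB
  typed⇒WF (⊢· ⊢M _)       = typed⇒WF ⊢M
  typed⇒WF (⊢conv ⊢M _ _)  = typed⇒WF ⊢M

  ctx-value : ∀ {n} {Γ : Ctx n} → WF Γ → ∃[ Γ′ ] ‖ Γ ‖≔ Γ′
  ctx-value {Γ = ∙}     _           = _ , empty
  ctx-value {Γ = _ ▹ _} (extend ⊢A) =
    let _ , γ = ctx-value (typed⇒WF ⊢A) ; _ , a = type-value′ ⊢A
    in  _ , extend γ a

{-# OPTIONS --safe #-}

-- The proof is a Kripke logical relation that interprets λΠ/S directly in λS, without any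
-- metatheory of λΠ/S. Terms of λΠ/S are first read as raw terms of λS (u_s as s, ε_s as the
-- identity on s, π̇ as a λ-abstracted Π), which turns βR-conversion into β-conversion and undoes
-- the translation up to β. A reading T that converts to a λS type T′ is interpreted by the raw
-- terms that convert to some λS proof of T′. A product Π A B that need not be a λS type is
-- interpreted by the raw terms M that map elements of A to elements of B in every extension of
-- the context and that moreover convert to a proof of every λS type convertible to Π A B. The
-- second condition makes the two interpretations agree wherever both apply, with no need to
-- decide whether S has a rule for Π A B; λ-abstractions satisfy it because a domain that is a λS
-- type is inhabited by a fresh variable. Evaluating a λΠ/S-inhabitant of ‖A‖ at the identity
-- substitution then gives a λS proof of A.

module Submission where

open import Defs
open import Data.Empty using (⊥; ⊥-elim)
open import Data.Fin.Base using (Fin; zero; suc)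
open import Data.Fin.Substitution using (Lift; Sub; Subs; TermSubst; module VarSubst)
open import Data.Fin.Substitution.Lemmas using (TermLemmas)
open import Data.Nat.Base using (ℕ; zero; suc)
open import Data.Product.Base using (Σ; ∃-syntax; _×_; _,_; proj₁; proj₂)
open import Data.Sum.Base using (inj₁; inj₂)
open import Data.Unit.Base using (⊤; tt)
open import Data.Vec.Base using ([]; _∷_; lookup; map)
import Data.Vec.Properties as Vec
open import Data.Vec.Relation.Binary.Pointwise.Inductive as Pointwise using (Pointwise; []; _∷_)
open import Level using (0ℓ)
open import Relation.Binary.Core using (Rel)
import Relation.Binary.Construct.Closure.Equivalence as Eq
open import Relation.Binary.Construct.Closure.ReflexiveTransitive as Star using (Star; ε; _◅_; _◅◅_)
open import Relation.Binary.Construct.Closure.Symmetric using (fwd; bwd)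
open import Relation.Binary.PropositionalEquality hiding ([_])
open import Relation.Nullary.Negation.Core using (¬_)

-- Substitution calculus of raw terms.

module SyntaxProperties (Sort Const : Set) where
  open Syntax Sort Const

  module ApplyProperties {T : ℕ → Set} (l : Lift T Term) where
    open TermSubst.Lifted termSubst l using (_↑✶_; _/✶_)

    sort-/✶ : ∀ k {m n s} (ρs : Subs T m n) → sort s /✶ ρs ↑✶ k ≡ sort s
    sort-/✶ k ε        = refl
    sort-/✶ k (ρ ◅ ρs) = cong (λ M → Apply._/_ l M _) (sort-/✶ k ρs)

    const-/✶ : ∀ k {m n c} (ρs : Subs T m n) → const c /✶ ρs ↑✶ k ≡ const c
    const-/✶ k ε        = refl
    const-/✶ k (ρ ◅ ρs) = cong (λ M → Apply._/_ l M _) (const-/✶ k ρs)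

    ·-/✶ : ∀ k {m n M N} (ρs : Subs T m n) →
           (M · N) /✶ ρs ↑✶ k ≡ (M /✶ ρs ↑✶ k) · (N /✶ ρs ↑✶ k)
    ·-/✶ k ε        = refl
    ·-/✶ k (ρ ◅ ρs) = cong (λ M → Apply._/_ l M _) (·-/✶ k ρs)

    ƛ-/✶ : ∀ k {m n A M} (ρs : Subs T m n) →
           ƛ A M /✶ ρs ↑✶ k ≡ ƛ (A /✶ ρs ↑✶ k) (M /✶ ρs ↑✶ suc k)
    ƛ-/✶ k ε        = refl
    ƛ-/✶ k (ρ ◅ ρs) = cong (λ M → Apply._/_ l M _) (ƛ-/✶ k ρs)

    Π-/✶ : ∀ k {m n A B} (ρs : Subs T m n) →
           Π A B /✶ ρs ↑✶ k ≡ Π (A /✶ ρs ↑✶ k) (B /✶ ρs ↑✶ suc k)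
    Π-/✶ k ε        = refl
    Π-/✶ k (ρ ◅ ρs) = cong (λ M → Apply._/_ l M _) (Π-/✶ k ρs)

  module _ {T₁ T₂ : ℕ → Set} {l₁ : Lift T₁ Term} {l₂ : Lift T₂ Term} where
    private
      module A₁ = ApplyProperties l₁
      module A₂ = ApplyProperties l₂
    open TermSubst.Lifted termSubst l₁ using () renaming (_↑✶_ to _↑✶₁_; _/✶_ to _/✶₁_)
    open TermSubst.Lifted termSubst l₂ using () renaming (_↑✶_ to _↑✶₂_; _/✶_ to _/✶₂_)

    /✶-↑✶ : ∀ {m n} (ρs₁ : Subs T₁ m n) (ρs₂ : Subs T₂ m n) →
            (∀ k x → var x /✶₁ ρs₁ ↑✶₁ k ≡ var x /✶₂ ρs₂ ↑✶₂ k) →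
            ∀ k M → M /✶₁ ρs₁ ↑✶₁ k ≡ M /✶₂ ρs₂ ↑✶₂ k
    /✶-↑✶ ρs₁ ρs₂ hyp k (sort s)  = trans (A₁.sort-/✶ k ρs₁) (sym (A₂.sort-/✶ k ρs₂))
    /✶-↑✶ ρs₁ ρs₂ hyp k (var x)   = hyp k x
    /✶-↑✶ ρs₁ ρs₂ hyp k (const c) = trans (A₁.const-/✶ k ρs₁) (sym (A₂.const-/✶ k ρs₂))
    /✶-↑✶ ρs₁ ρs₂ hyp k (M · N)   = trans (A₁.·-/✶ k ρs₁) (trans
      (cong₂ _·_ (/✶-↑✶ ρs₁ ρs₂ hyp k M) (/✶-↑✶ ρs₁ ρs₂ hyp k N))
      (sym (A₂.·-/✶ k ρs₂)))
    /✶-↑✶ ρs₁ ρs₂ hyp k (ƛ A M)   = trans (A₁.ƛ-/✶ k ρs₁) (trans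
      (cong₂ ƛ (/✶-↑✶ ρs₁ ρs₂ hyp k A) (/✶-↑✶ ρs₁ ρs₂ hyp (suc k) M))
      (sym (A₂.ƛ-/✶ k ρs₂)))
    /✶-↑✶ ρs₁ ρs₂ hyp k (Π A B)   = trans (A₁.Π-/✶ k ρs₁) (trans
      (cong₂ Π (/✶-↑✶ ρs₁ ρs₂ hyp k A) (/✶-↑✶ ρs₁ ρs₂ hyp (suc k) B))
      (sym (A₂.Π-/✶ k ρs₂)))

  termLemmas : TermLemmas Term
  termLemmas = record { termSubst = termSubst ; app-var = refl ; /✶-↑✶ = /✶-↑✶ }

  open TermSubst termSubst public using (_↑; wk; id; _⊙_; _/Var_)
  open TermLemmas termLemmas public
    using (id-vanishes; /-⊙; weaken-↑; weaken-∷; weaken-sub; sub-commutes;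
           sub-commutes-with-renaming; lookup-id; lookup-wk; id-⊙;
           weaken-var; map-weaken-⊙-sub; map-weaken)

  /-wk : ∀ {n} (M : Term n) → M / wk ≡ weaken M
  /-wk M = TermLemmas./-wk termLemmas {t = M}

  lookup-weaken : ∀ {m n} (σ : Sub Term m n) x →
                  lookup (map weaken σ) x ≡ weaken (lookup σ x)
  lookup-weaken σ x = Vec.lookup-map x weaken σ

  ↑-⊙-sub : ∀ {m n} (σ : Sub Term m n) N → (σ ↑) ⊙ sub N ≡ N ∷ σ
  ↑-⊙-sub σ N = cong (N ∷_) map-weaken-⊙-sub

  ↑-/-sub : ∀ {m n} (B : Term (suc m)) (σ : Sub Term m n) N →
            (B / σ ↑) [ N ] ≡ B / (N ∷ σ)
  ↑-/-sub B σ N = trans (sym (/-⊙ B)) (cong (B /_) (↑-⊙-sub σ N))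

  ↑-/-∷ : ∀ {m n o} (B : Term (suc m)) (σ : Sub Term m n) (τ : Sub Term n o) N →
          (B / σ ↑) / (N ∷ τ) ≡ B / (N ∷ (σ ⊙ τ))
  ↑-/-∷ B σ τ N = trans (cong ((B / σ ↑) /_) (sym (↑-⊙-sub τ N))) (trans (/-⊙ (B / σ ↑)) (trans
    (cong (_[ N ]) (trans (sym (/-⊙ B)) (cong (B /_) (sym lemma)))) (↑-/-sub B (σ ⊙ τ) N)))
    where
    lemma : (σ ⊙ τ) ↑ ≡ (σ ↑) ⊙ (τ ↑)
    lemma = TermLemmas.↑⋆-distrib termLemmas 1

-- β-conversion: congruence, substitution and confluence.

module BetaReduction (S : Spec) where
  open λS S
  open SyntaxProperties Sort Const

  infix 4 _→β_ _↠_ _⇛_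

  _→β_ _↠_ : ∀ {n} → Rel (Term n) 0ℓ
  _→β_ = Contextual βStep
  _↠_  = Star _→β_

  ¬RStep : ∀ {n} {M N : Term n} → ¬ Contextual RStep M N
  ¬RStep (step (rewrite-by () σ))
  ¬RStep (·ˡ r) = ¬RStep r
  ¬RStep (·ʳ r) = ¬RStep r
  ¬RStep (ƛˡ r) = ¬RStep r
  ¬RStep (ƛʳ r) = ¬RStep r
  ¬RStep (Πˡ r) = ¬RStep r
  ¬RStep (Πʳ r) = ¬RStep r

  ⟶⇒→β : ∀ {n} {M N : Term n} → M ⟶ N → M →β N
  ⟶⇒→β (inj₁ r) = r
  ⟶⇒→β (inj₂ r) = ⊥-elim (¬RStep r)

  →β⇒≈ : ∀ {n} {M N : Term n} → M →β N → M ≈ N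
  →β⇒≈ r = Eq.return (inj₁ r)

  ↠⇒≈ : ∀ {n} {M N : Term n} → M ↠ N → M ≈ N
  ↠⇒≈ = Star.map (λ r → fwd (inj₁ r))

  ≈-refl : ∀ {n} {M : Term n} → M ≈ M
  ≈-refl = ε

  ≈-sym : ∀ {n} {M N : Term n} → M ≈ N → N ≈ M
  ≈-sym = Eq.symmetric _⟶_

  ≈-trans : ∀ {n} {M N P : Term n} → M ≈ N → N ≈ P → M ≈ P
  ≈-trans = _◅◅_

  ≡⇒≈ : ∀ {n} {M N : Term n} → M ≡ N → M ≈ N
  ≡⇒≈ refl = ε

  ≈-map : ∀ {m n} (f : Term m → Term n) →
          (∀ {M N} → M →β N → f M →β f N) → ∀ {M N} → M ≈ N → f M ≈ f N
  ≈-map f g = Eq.gmap f (λ r → inj₁ (g (⟶⇒→β r)))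

  ≈-· : ∀ {n} {M M′ N N′ : Term n} → M ≈ M′ → N ≈ N′ → M · N ≈ M′ · N′
  ≈-· p q = ≈-trans (≈-map (_· _) ·ˡ p) (≈-map (_ ·_) ·ʳ q)

  ≈-ƛ : ∀ {n} {A A′ : Term n} {M M′} → A ≈ A′ → M ≈ M′ → ƛ A M ≈ ƛ A′ M′
  ≈-ƛ p q = ≈-trans (≈-map (λ A → ƛ A _) ƛˡ p) (≈-map (ƛ _) ƛʳ q)

  ≈-Π : ∀ {n} {A A′ : Term n} {B B′} → A ≈ A′ → B ≈ B′ → Π A B ≈ Π A′ B′
  ≈-Π p q = ≈-trans (≈-map (λ A → Π A _) Πˡ p) (≈-map (Π _) Πʳ q)

  →β-/ : ∀ {m n} {M N : Term m} (σ : Sub Term m n) → M →β N → M / σ →β N / σ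
  →β-/ σ (step (β {A} {M} {N})) =
    subst (ƛ A M · N / σ →β_) (sym (sub-commutes {t′ = N} M)) (step β)
  →β-/ σ (·ˡ r) = ·ˡ (→β-/ σ r)
  →β-/ σ (·ʳ r) = ·ʳ (→β-/ σ r)
  →β-/ σ (ƛˡ r) = ƛˡ (→β-/ σ r)
  →β-/ σ (ƛʳ r) = ƛʳ (→β-/ (σ ↑) r)
  →β-/ σ (Πˡ r) = Πˡ (→β-/ σ r)
  →β-/ σ (Πʳ r) = Πʳ (→β-/ (σ ↑) r)

  ≈-/ : ∀ {m n} {M N : Term m} (σ : Sub Term m n) → M ≈ N → M / σ ≈ N / σ
  ≈-/ σ = ≈-map (_/ σ) (→β-/ σ)

  ≈-weaken : ∀ {n} {M N : Term n} → M ≈ N → weaken M ≈ weaken N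
  ≈-weaken {M = M} {N} p = subst₂ _≈_ (/-wk M) (/-wk N) (≈-/ wk p)

  ≈-↑ : ∀ {m n} {σ τ : Sub Term m n} → Pointwise _≈_ σ τ → Pointwise _≈_ (σ ↑) (τ ↑)
  ≈-↑ p = ≈-refl ∷ Pointwise.map⁺ ≈-weaken p

  /-≈ : ∀ {m n} (M : Term m) {σ τ : Sub Term m n} → Pointwise _≈_ σ τ → M / σ ≈ M / τ
  /-≈ (sort s)  p = ≈-refl
  /-≈ (var x)   p = Pointwise.lookup p x
  /-≈ (const c) p = ≈-refl
  /-≈ (M · N)   p = ≈-· (/-≈ M p) (/-≈ N p)
  /-≈ (ƛ A M)   p = ≈-ƛ (/-≈ A p) (/-≈ M (≈-↑ p))
  /-≈ (Π A B)   p = ≈-Π (/-≈ A p) (/-≈ B (≈-↑ p))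

  ∷-≈ : ∀ {m n} {M N : Term (suc m)} {P Q} (σ : Sub Term m n) →
        M ≈ N → P ≈ Q → M / (P ∷ σ) ≈ N / (Q ∷ σ)
  ∷-≈ {N = N} σ p q =
    ≈-trans (≈-/ _ p) (/-≈ N (q ∷ Pointwise.refl ≈-refl))

  -- Confluence, by the complete developments of Takahashi.

  data _⇛_ {n} : Rel (Term n) 0ℓ where
    sort : ∀ {s} → sort s ⇛ sort s
    var  : ∀ {x} → var x ⇛ var x
    _·_  : ∀ {M M′ N N′} → M ⇛ M′ → N ⇛ N′ → M · N ⇛ M′ · N′
    ƛ    : ∀ {A A′ M M′} → A ⇛ A′ → M ⇛ M′ → ƛ A M ⇛ ƛ A′ M′
    Π    : ∀ {A A′ B B′} → A ⇛ A′ → B ⇛ B′ → Π A B ⇛ Π A′ B′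
    β    : ∀ {A M M′ N N′} → M ⇛ M′ → N ⇛ N′ → ƛ A M · N ⇛ M′ [ N′ ]

  ⇛-refl : ∀ {n} (M : Term n) → M ⇛ M
  ⇛-refl (sort s)  = sort
  ⇛-refl (var x)   = var
  ⇛-refl (M · N)   = ⇛-refl M · ⇛-refl N
  ⇛-refl (ƛ A M)   = ƛ (⇛-refl A) (⇛-refl M)
  ⇛-refl (Π A B)   = Π (⇛-refl A) (⇛-refl B)

  →β⇒⇛ : ∀ {n} {M N : Term n} → M →β N → M ⇛ N
  →β⇒⇛ (step β) = β (⇛-refl _) (⇛-refl _)
  →β⇒⇛ (·ˡ r)   = →β⇒⇛ r · ⇛-refl _
  →β⇒⇛ (·ʳ r)   = ⇛-refl _ · →β⇒⇛ r
  →β⇒⇛ (ƛˡ r)   = ƛ (→β⇒⇛ r) (⇛-refl _)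
  →β⇒⇛ (ƛʳ r)   = ƛ (⇛-refl _) (→β⇒⇛ r)
  →β⇒⇛ (Πˡ r)   = Π (→β⇒⇛ r) (⇛-refl _)
  →β⇒⇛ (Πʳ r)   = Π (⇛-refl _) (→β⇒⇛ r)

  ↠-· : ∀ {n} {M M′ N N′ : Term n} → M ↠ M′ → N ↠ N′ → M · N ↠ M′ · N′
  ↠-· p q = Star.gmap (_· _) ·ˡ p ◅◅ Star.gmap (_ ·_) ·ʳ q

  ↠-ƛ : ∀ {n} {A A′ : Term n} {M M′} → A ↠ A′ → M ↠ M′ → ƛ A M ↠ ƛ A′ M′
  ↠-ƛ p q = Star.gmap (λ A → ƛ A _) ƛˡ p ◅◅ Star.gmap (ƛ _) ƛʳ q

  ↠-Π : ∀ {n} {A A′ : Term n} {B B′} → A ↠ A′ → B ↠ B′ → Π A B ↠ Π A′ B′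
  ↠-Π p q = Star.gmap (λ A → Π A _) Πˡ p ◅◅ Star.gmap (Π _) Πʳ q

  ⇛⇒↠ : ∀ {n} {M N : Term n} → M ⇛ N → M ↠ N
  ⇛⇒↠ sort    = ε
  ⇛⇒↠ var     = ε
  ⇛⇒↠ (m · n) = ↠-· (⇛⇒↠ m) (⇛⇒↠ n)
  ⇛⇒↠ (ƛ a m) = ↠-ƛ (⇛⇒↠ a) (⇛⇒↠ m)
  ⇛⇒↠ (Π a b) = ↠-Π (⇛⇒↠ a) (⇛⇒↠ b)
  ⇛⇒↠ (β m n) = ↠-· (↠-ƛ ε (⇛⇒↠ m)) (⇛⇒↠ n) ◅◅ step β ◅ ε

  ⇛-/Var : ∀ {m n} {M N : Term m} (ρ : Sub Fin m n) → M ⇛ N → M /Var ρ ⇛ N /Var ρ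
  ⇛-/Var ρ sort    = sort
  ⇛-/Var ρ var     = var
  ⇛-/Var ρ (m · n) = ⇛-/Var ρ m · ⇛-/Var ρ n
  ⇛-/Var ρ (ƛ a m) = ƛ (⇛-/Var ρ a) (⇛-/Var (ρ VarSubst.↑) m)
  ⇛-/Var ρ (Π a b) = Π (⇛-/Var ρ a) (⇛-/Var (ρ VarSubst.↑) b)
  ⇛-/Var ρ (β {A} {M} {M′} {N} {N′} m n) =
    subst ((ƛ A M · N) /Var ρ ⇛_) (sym (sub-commutes-with-renaming {t = M′} {t′ = N′}))
      (β (⇛-/Var (ρ VarSubst.↑) m) (⇛-/Var ρ n))

  ⇛-↑ : ∀ {m n} {σ τ : Sub Term m n} → Pointwise _⇛_ σ τ → Pointwise _⇛_ (σ ↑) (τ ↑)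
  ⇛-↑ p = var ∷ Pointwise.map⁺ (⇛-/Var VarSubst.wk) p

  ⇛-/ : ∀ {m n} {M N : Term m} {σ τ : Sub Term m n} →
        M ⇛ N → Pointwise _⇛_ σ τ → M / σ ⇛ N / τ
  ⇛-/ sort p            = sort
  ⇛-/ (var {x}) p       = Pointwise.lookup p x
  ⇛-/ (m · n) p         = ⇛-/ m p · ⇛-/ n p
  ⇛-/ (ƛ a m) p         = ƛ (⇛-/ a p) (⇛-/ m (⇛-↑ p))
  ⇛-/ (Π a b) p         = Π (⇛-/ a p) (⇛-/ b (⇛-↑ p))
  ⇛-/ {σ = σ} (β {A} {M} {M′} {N} {N′} m n) p =
    subst ((ƛ A M · N) / σ ⇛_) (sym (sub-commutes {t′ = N′} M′))
      (β (⇛-/ m (⇛-↑ p)) (⇛-/ n p))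

  ⇛-[] : ∀ {n} {M M′ : Term (suc n)} {N N′} → M ⇛ M′ → N ⇛ N′ → M [ N ] ⇛ M′ [ N′ ]
  ⇛-[] m n = ⇛-/ m (n ∷ Pointwise.refl (⇛-refl _))

  develop : ∀ {n} → Term n → Term n
  develop (sort s)    = sort s
  develop (var x)     = var x
  develop (ƛ A M · N) = develop M [ develop N ]
  develop (M · N)     = develop M · develop N
  develop (ƛ A M)     = ƛ (develop A) (develop M)
  develop (Π A B)     = Π (develop A) (develop B)

  -- The triangle property. The complete development depends on `M` alone, so any two parallel
  -- reducts of `M` meet there.
  ⇛-develop : ∀ {n} {M N : Term n} → M ⇛ N → N ⇛ develop M
  ⇛-develop sort               = sort
  ⇛-develop var                = var
  -- The derivation for the function part is split so that `develop` sees a head that is not an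
  -- abstraction and computes to an application.
  ⇛-develop (m@sort · n)       = ⇛-develop m · ⇛-develop n
  ⇛-develop (m@var · n)        = ⇛-develop m · ⇛-develop n
  ⇛-develop (m@(_ · _) · n)    = ⇛-develop m · ⇛-develop n
  ⇛-develop (m@(Π _ _) · n)    = ⇛-develop m · ⇛-develop n
  ⇛-develop (m@(β _ _) · n)    = ⇛-develop m · ⇛-develop n
  ⇛-develop (ƛ _ m · n)        = β (⇛-develop m) (⇛-develop n)
  ⇛-develop (ƛ a m)            = ƛ (⇛-develop a) (⇛-develop m)
  ⇛-develop (Π a b)            = Π (⇛-develop a) (⇛-develop b)
  ⇛-develop (β m n)            = ⇛-[] (⇛-develop m) (⇛-develop n)

  strip : ∀ {n} {M N P : Term n} → M ⇛ N → Star _⇛_ M P →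
          ∃[ Q ] Star _⇛_ N Q × P ⇛ Q
  strip r ε        = _ , ε , r
  strip r (t ◅ ts) =
    let Q , qs , q = strip (⇛-develop t) ts in Q , ⇛-develop r ◅ qs , q

  church-rosser : ∀ {n} {M N : Term n} → M ≈ N → ∃[ P ] M ↠ P × N ↠ P
  church-rosser p = let P , ms , ns = go p in P , collapse ms , collapse ns
    where
    collapse : ∀ {n} {M N : Term n} → Star _⇛_ M N → M ↠ N
    collapse ts = Star.concat (Star.map ⇛⇒↠ ts)
    go : ∀ {n} {M N : Term n} → M ≈ N → ∃[ P ] Star _⇛_ M P × Star _⇛_ N P
    go ε = _ , ε , ε
    go (fwd r ◅ p) =
      let P , ms , ns = go p in P , →β⇒⇛ (⟶⇒→β r) ◅ ms , ns
    go (bwd r ◅ p) =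
      let P , ms , ns = go p ; Q , qs , q = strip (→β⇒⇛ (⟶⇒→β r)) ms
      in  Q , qs , ns ◅◅ q ◅ ε

  -- Shapes of reducts, and injectivity of sorts and products.

  sort-↠ : ∀ {n} {s} {M : Term n} → sort s ↠ M → M ≡ sort s
  sort-↠ ε = refl
  sort-↠ (step () ◅ _)

  Π-↠ : ∀ {n} {A : Term n} {B M} → Π A B ↠ M →
        ∃[ A′ ] ∃[ B′ ] M ≡ Π A′ B′ × A ↠ A′ × B ↠ B′
  Π-↠ ε = _ , _ , refl , ε , ε
  Π-↠ (step () ◅ _)
  Π-↠ (Πˡ r ◅ rs) = let _ , _ , e , a , b = Π-↠ rs in _ , _ , e , r ◅ a , b
  Π-↠ (Πʳ r ◅ rs) = let _ , _ , e , a , b = Π-↠ rs in _ , _ , e , a , r ◅ b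

  ƛ-↠ : ∀ {n} {A : Term n} {M N} → ƛ A M ↠ N →
        ∃[ A′ ] ∃[ M′ ] N ≡ ƛ A′ M′ × A ↠ A′ × M ↠ M′
  ƛ-↠ ε = _ , _ , refl , ε , ε
  ƛ-↠ (step () ◅ _)
  ƛ-↠ (ƛˡ r ◅ rs) = let _ , _ , e , a , b = ƛ-↠ rs in _ , _ , e , r ◅ a , b
  ƛ-↠ (ƛʳ r ◅ rs) = let _ , _ , e , a , b = ƛ-↠ rs in _ , _ , e , a , r ◅ b

  ≈sort : ∀ {n} {s} {M : Term n} → M ≈ sort s → M ↠ sort s
  ≈sort p with church-rosser p
  ... | _ , m , n with sort-↠ n
  ... | refl = m

  ≈Π : ∀ {n} {A : Term n} {B M} → M ≈ Π A B →
       ∃[ A′ ] ∃[ B′ ] M ↠ Π A′ B′ × A ≈ A′ × B ≈ B′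
  ≈Π p with church-rosser p
  ... | _ , m , n with Π-↠ n
  ... | _ , _ , refl , a , b = _ , _ , m , ↠⇒≈ a , ↠⇒≈ b

  sort-injective : ∀ {n} {s s′} → sort {n} s ≈ sort s′ → s ≡ s′
  sort-injective p with sort-↠ (≈sort p)
  ... | refl = refl

  Π-injective : ∀ {n} {A A′ : Term n} {B B′} → Π A B ≈ Π A′ B′ → A ≈ A′ × B ≈ B′
  Π-injective p with ≈Π p
  ... | _ , _ , m , a , b with Π-↠ m
  ... | _ , _ , refl , a′ , b′ = ≈-trans (↠⇒≈ a′) (≈-sym a) , ≈-trans (↠⇒≈ b′) (≈-sym b)

  sort≉Π : ∀ {n} {s} {A : Term n} {B} → ¬ sort s ≈ Π A B
  sort≉Π p with ≈Π p
  ... | _ , _ , m , _ with sort-↠ m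
  ... | ()

-- Metatheory of λS: substitution, generation and subject reduction.

module PTSMetatheory (S : Spec) where
  open λS S
  open SyntaxProperties Sort Const
  open BetaReduction S
  open Translation S using (typed⇒WF)

  ⊢-≡ : ∀ {n} {Γ : Ctx n} {M N A B} → M ≡ N → A ≡ B → Γ ⊢ M ∶ A → Γ ⊢ N ∶ B
  ⊢-≡ refl refl ⊢M = ⊢M

  -- Abstract in the class of substitutions because it is used twice: renamings come first and give
  -- weakening, which in turn lifts typed substitutions under binders.
  module SubstitutionLemma
    (Mor   : ∀ {m n} → Ctx m → Ctx n → Sub Term m n → Set)
    (⊢look : ∀ {m n} {Γ : Ctx m} {Δ : Ctx n} {σ} → WF Δ → Mor Γ Δ σ →
             ∀ x → Δ ⊢ lookup σ x ∶ typeOf Γ x / σ)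
    (lift  : ∀ {m n} {Γ : Ctx m} {Δ : Ctx n} {σ A} → WF (Δ ▹ A / σ) → Mor Γ Δ σ →
             Mor (Γ ▹ A) (Δ ▹ A / σ) (σ ↑))
    where

    ⊢-/ : ∀ {m n} {Γ : Ctx m} {Δ : Ctx n} {σ M A} →
          Γ ⊢ M ∶ A → WF Δ → Mor Γ Δ σ → Δ ⊢ M / σ ∶ A / σ
    -- The λ rule types the domain only inside the derivation for `Π A B`. Descending through that
    -- derivation keeps the recursion structural, which substituting into the output of a generation
    -- lemma would not.
    ⊢Π-domain : ∀ {m n} {Γ : Ctx m} {Δ : Ctx n} {σ A B C} →
                Γ ⊢ Π A B ∶ C → WF Δ → Mor Γ Δ σ → ∃[ s ] Δ ⊢ A / σ ∶ sort s

    ⊢-/ (⊢var x _) wf σ⊢       = ⊢look wf σ⊢ x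
    ⊢-/ (⊢sort _ a) wf σ⊢      = ⊢sort wf a
    ⊢-/ (⊢Π ⊢A ⊢B r) wf σ⊢     =
      let ⊢A′ = ⊢-/ ⊢A wf σ⊢
      in  ⊢Π ⊢A′ (⊢-/ ⊢B (extend ⊢A′) (lift (extend ⊢A′) σ⊢)) r
    ⊢-/ (⊢ƛ ⊢M ⊢ΠAB) wf σ⊢     =
      let _ , ⊢A′ = ⊢Π-domain ⊢ΠAB wf σ⊢
      in  ⊢ƛ (⊢-/ ⊢M (extend ⊢A′) (lift (extend ⊢A′) σ⊢)) (⊢-/ ⊢ΠAB wf σ⊢)
    ⊢-/ (⊢· {B = B} {N = N} ⊢M ⊢N) wf σ⊢ =
      ⊢-≡ refl (sym (sub-commutes {t′ = N} B))
        (⊢· (⊢-/ ⊢M wf σ⊢) (⊢-/ ⊢N wf σ⊢))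
    ⊢-/ (⊢conv ⊢M ⊢B A≈B) wf σ⊢ =
      ⊢conv (⊢-/ ⊢M wf σ⊢) (⊢-/ ⊢B wf σ⊢) (≈-/ _ A≈B)

    ⊢Π-domain (⊢Π ⊢A _ _)    wf σ⊢ = _ , ⊢-/ ⊢A wf σ⊢
    ⊢Π-domain (⊢conv ⊢M _ _) wf σ⊢ = ⊢Π-domain ⊢M wf σ⊢

  record Renaming {m n} (Γ : Ctx m) (Δ : Ctx n) (σ : Sub Term m n) : Set where
    constructor mkRenaming
    field image : ∀ x → ∃[ y ] lookup σ x ≡ var y × typeOf Δ y ≡ typeOf Γ x / σ
  open Renaming

  renaming-lookup : ∀ {m n} {Γ : Ctx m} {Δ : Ctx n} {σ} → WF Δ → Renaming Γ Δ σ →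
                    ∀ x → Δ ⊢ lookup σ x ∶ typeOf Γ x / σ
  renaming-lookup wf r x =
    let y , p , q = image r x in ⊢-≡ (sym p) q (⊢var y wf)

  renaming-↑ : ∀ {m n} {Γ : Ctx m} {Δ : Ctx n} {σ A} → WF (Δ ▹ A / σ) → Renaming Γ Δ σ →
               Renaming (Γ ▹ A) (Δ ▹ A / σ) (σ ↑)
  renaming-↑ {Γ = Γ} {σ = σ} {A} _ r = mkRenaming λ where
    zero    → zero , refl , sym (weaken-↑ A)
    (suc x) → let y , p , q = image r x in
      suc y , trans (lookup-weaken σ x) (trans (cong weaken p) weaken-var)
            , trans (cong weaken q) (sym (weaken-↑ (typeOf Γ x)))

  renaming-wk : ∀ {n} {Γ : Ctx n} {A} → Renaming Γ (Γ ▹ A) wk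
  renaming-wk {Γ = Γ} = mkRenaming λ x → suc x , lookup-wk x , sym (/-wk (typeOf Γ x))

  ⊢-weaken : ∀ {n} {Γ : Ctx n} {M A B} → WF (Γ ▹ B) → Γ ⊢ M ∶ A → Γ ▹ B ⊢ weaken M ∶ weaken A
  ⊢-weaken {M = M} {A} wf ⊢M =
    ⊢-≡ (/-wk M) (/-wk A) (⊢-/ ⊢M wf renaming-wk)
    where open SubstitutionLemma Renaming renaming-lookup renaming-↑

  infix 4 _⊢ₛ_∶_

  -- These are the changes of world of the logical relation. The field `wf` is separate because an
  -- empty `Γ` makes `⊢look` vacuous.
  record _⊢ₛ_∶_ {m n} (Δ : Ctx n) (σ : Sub Term m n) (Γ : Ctx m) : Set where
    constructor substitution
    field
      wf    : WF Δ
      ⊢look : ∀ x → Δ ⊢ lookup σ x ∶ typeOf Γ x / σ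
  open _⊢ₛ_∶_ public

  ⊢ₛ-↑ : ∀ {m n} {Γ : Ctx m} {Δ : Ctx n} {σ A} → WF (Δ ▹ A / σ) → Δ ⊢ₛ σ ∶ Γ →
         Δ ▹ A / σ ⊢ₛ σ ↑ ∶ Γ ▹ A
  ⊢ₛ-↑ {Γ = Γ} {σ = σ} {A} wf′ σ⊢ = substitution wf′ λ where
    zero    → ⊢-≡ refl (sym (weaken-↑ A)) (⊢var zero wf′)
    (suc x) → ⊢-≡ (sym (lookup-weaken σ x)) (sym (weaken-↑ (typeOf Γ x)))
                (⊢-weaken wf′ (⊢look σ⊢ x))

  ⊢-/ : ∀ {m n} {Γ : Ctx m} {Δ : Ctx n} {σ M A} →
        Γ ⊢ M ∶ A → Δ ⊢ₛ σ ∶ Γ → Δ ⊢ M / σ ∶ A / σ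
  ⊢-/ ⊢M σ⊢ = SubstitutionLemma.⊢-/ (λ Γ Δ σ → Δ ⊢ₛ σ ∶ Γ) (λ _ → ⊢look) ⊢ₛ-↑ ⊢M (wf σ⊢) σ⊢

  ⊢ₛ-∷ : ∀ {m n} {Γ : Ctx m} {Δ : Ctx n} {σ A N} → Δ ⊢ₛ σ ∶ Γ → Δ ⊢ N ∶ A / σ →
         Δ ⊢ₛ N ∷ σ ∶ Γ ▹ A
  ⊢ₛ-∷ {Γ = Γ} {A = A} σ⊢ ⊢N = substitution (wf σ⊢) λ where
    zero    → ⊢-≡ refl (sym (weaken-∷ A)) ⊢N
    (suc x) → ⊢-≡ refl (sym (weaken-∷ (typeOf Γ x))) (⊢look σ⊢ x)

  ⊢ₛ-id : ∀ {n} {Γ : Ctx n} → WF Γ → Γ ⊢ₛ id ∶ Γ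
  ⊢ₛ-id wf = substitution wf λ x →
    ⊢-≡ (sym (lookup-id x)) (sym (id-vanishes _)) (⊢var x wf)

  ⊢ₛ-wk : ∀ {n} {Γ : Ctx n} {A} → WF (Γ ▹ A) → Γ ▹ A ⊢ₛ wk ∶ Γ
  ⊢ₛ-wk wf = substitution wf (renaming-lookup wf renaming-wk)

  ⊢ₛ-⊙ : ∀ {m n o} {Γ : Ctx m} {Δ : Ctx n} {Ξ : Ctx o} {σ τ} →
         Δ ⊢ₛ σ ∶ Γ → Ξ ⊢ₛ τ ∶ Δ → Ξ ⊢ₛ σ ⊙ τ ∶ Γ
  ⊢ₛ-⊙ {Γ = Γ} {σ = σ} σ⊢ τ⊢ = substitution (wf τ⊢) λ x →
    ⊢-≡ (sym (Vec.lookup-map x _ σ)) (sym (/-⊙ (typeOf Γ x)))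
      (⊢-/ (⊢look σ⊢ x) τ⊢)

  ⊢-[] : ∀ {n} {Γ : Ctx n} {A B M N} → Γ ▹ A ⊢ M ∶ B → Γ ⊢ N ∶ A → Γ ⊢ M [ N ] ∶ B [ N ]
  ⊢-[] ⊢M ⊢N =
    ⊢-/ ⊢M (⊢ₛ-∷ (⊢ₛ-id (typed⇒WF ⊢N)) (⊢-≡ refl (sym (id-vanishes _)) ⊢N))

  -- `var zero ∷ wk` is the identity, and it is a typed substitution between the two contexts once
  -- `var zero` is retyped by conversion.
  ⊢-ctx-conv : ∀ {n} {Γ : Ctx n} {A A′ B M s s′} → A ≈ A′ → Γ ⊢ A ∶ sort s → Γ ⊢ A′ ∶ sort s′ →
               Γ ▹ A ⊢ M ∶ B → Γ ▹ A′ ⊢ M ∶ B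
  ⊢-ctx-conv {A = A} {A′} A≈A′ ⊢A ⊢A′ ⊢M =
    ⊢-≡ (id-vanishes _) (id-vanishes _) (⊢-/ ⊢M (⊢ₛ-∷ (⊢ₛ-wk wf′)
      (⊢-≡ refl (sym (/-wk A)) (⊢conv (⊢var zero wf′) (⊢-weaken wf′ ⊢A)
        (≈-sym (≈-weaken A≈A′))))))
    where wf′ = extend ⊢A′

  generation-Π : ∀ {n} {Γ : Ctx n} {A B C} → Γ ⊢ Π A B ∶ C →
                 ∃[ s₁ ] ∃[ s₂ ] ∃[ s₃ ]
                 Γ ⊢ A ∶ sort s₁ × Γ ▹ A ⊢ B ∶ sort s₂ × Rule s₁ s₂ s₃ × sort s₃ ≈ C
  generation-Π (⊢Π ⊢A ⊢B r)     = _ , _ , _ , ⊢A , ⊢B , r , ≈-refl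
  generation-Π (⊢conv ⊢M _ C≈D) =
    let _ , _ , _ , ⊢A , ⊢B , r , s≈C = generation-Π ⊢M
    in  _ , _ , _ , ⊢A , ⊢B , r , ≈-trans s≈C C≈D

  generation-ƛ : ∀ {n} {Γ : Ctx n} {A M C} → Γ ⊢ ƛ A M ∶ C →
                 ∃[ B ] ∃[ s ] Γ ▹ A ⊢ M ∶ B × Γ ⊢ Π A B ∶ sort s × Π A B ≈ C
  generation-ƛ (⊢ƛ ⊢M ⊢ΠAB)     = _ , _ , ⊢M , ⊢ΠAB , ≈-refl
  generation-ƛ (⊢conv ⊢M _ C≈D) =
    let _ , _ , ⊢M′ , ⊢ΠAB , e = generation-ƛ ⊢M in _ , _ , ⊢M′ , ⊢ΠAB , ≈-trans e C≈D

  ⊢typeOf : ∀ {n} {Γ : Ctx n} → WF Γ → ∀ x → ∃[ s ] Γ ⊢ typeOf Γ x ∶ sort s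
  ⊢typeOf (extend ⊢A) zero    = _ , ⊢-weaken (extend ⊢A) ⊢A
  ⊢typeOf (extend ⊢A) (suc x) =
    let _ , ⊢T = ⊢typeOf (typed⇒WF ⊢A) x in _ , ⊢-weaken (extend ⊢A) ⊢T

  type-correctness : ∀ {n} {Γ : Ctx n} {M A} → Γ ⊢ M ∶ A → IsType Γ A
  type-correctness (⊢var x wf)     = wf , inj₁ (⊢typeOf wf x)
  type-correctness (⊢sort wf _)    = wf , inj₂ (_ , refl)
  type-correctness (⊢Π ⊢A _ _)     = typed⇒WF ⊢A , inj₂ (_ , refl)
  type-correctness (⊢ƛ _ ⊢ΠAB)     = typed⇒WF ⊢ΠAB , inj₁ (_ , ⊢ΠAB)
  type-correctness (⊢· ⊢M ⊢N) with type-correctness ⊢M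
  ... | wf , inj₁ (_ , ⊢ΠAB) =
    let _ , _ , _ , _ , ⊢B , _ = generation-Π ⊢ΠAB in wf , inj₁ (_ , ⊢-[] ⊢B ⊢N)
  type-correctness (⊢conv _ ⊢B _)  = typed⇒WF ⊢B , inj₁ (_ , ⊢B)

  IsType-/ : ∀ {m n} {Γ : Ctx m} {Δ : Ctx n} {σ A} → IsType Γ A → Δ ⊢ₛ σ ∶ Γ → IsType Δ (A / σ)
  IsType-/ (_ , inj₁ (_ , ⊢A))   σ⊢ = wf σ⊢ , inj₁ (_ , ⊢-/ ⊢A σ⊢)
  IsType-/ (_ , inj₂ (_ , refl)) σ⊢ = wf σ⊢ , inj₂ (_ , refl)

  subject-reduction : ∀ {n} {Γ : Ctx n} {M N A} → Γ ⊢ M ∶ A → M →β N → Γ ⊢ N ∶ A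
  subject-reduction (⊢var _ _)  (step ())
  subject-reduction (⊢sort _ _) (step ())
  subject-reduction (⊢Π ⊢A ⊢B r) (Πˡ t) =
    let ⊢A′ = subject-reduction ⊢A t
    in  ⊢Π ⊢A′ (⊢-ctx-conv (→β⇒≈ t) ⊢A ⊢A′ ⊢B) r
  subject-reduction (⊢Π ⊢A ⊢B r) (Πʳ t) = ⊢Π ⊢A (subject-reduction ⊢B t) r
  subject-reduction (⊢ƛ ⊢M ⊢ΠAB) (ƛˡ t) =
    let ⊢ΠA′B = subject-reduction ⊢ΠAB (Πˡ t)
        _ , _ , _ , ⊢A , _ = generation-Π ⊢ΠAB
        _ , _ , _ , ⊢A′ , _ = generation-Π ⊢ΠA′B
    in  ⊢conv (⊢ƛ (⊢-ctx-conv (→β⇒≈ t) ⊢A ⊢A′ ⊢M) ⊢ΠA′B) ⊢ΠAB (≈-sym (→β⇒≈ (Πˡ t)))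
  subject-reduction (⊢ƛ ⊢M ⊢ΠAB) (ƛʳ t) = ⊢ƛ (subject-reduction ⊢M t) ⊢ΠAB
  subject-reduction (⊢· ⊢M ⊢N) (step β) with type-correctness ⊢M | generation-ƛ ⊢M
  ... | _ , inj₁ (_ , ⊢ΠAB) | _ , _ , ⊢M′ , ⊢ΠA₀B₀ , e =
    let _ , _ , _ , _ , ⊢B , _  = generation-Π ⊢ΠAB
        _ , _ , _ , ⊢A₀ , _     = generation-Π ⊢ΠA₀B₀
        A₀≈A , B₀≈B             = Π-injective e
    in  ⊢conv (⊢-[] ⊢M′ (⊢conv ⊢N ⊢A₀ (≈-sym A₀≈A))) (⊢-[] ⊢B ⊢N) (≈-/ _ B₀≈B)
  subject-reduction (⊢· ⊢M ⊢N) (·ˡ t) = ⊢· (subject-reduction ⊢M t) ⊢N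
  subject-reduction (⊢· {B = B} ⊢M ⊢N) (·ʳ t) with type-correctness ⊢M
  ... | _ , inj₁ (_ , ⊢ΠAB) =
    let _ , _ , _ , _ , ⊢B , _ = generation-Π ⊢ΠAB
    in  ⊢conv (⊢· ⊢M (subject-reduction ⊢N t)) (⊢-[] ⊢B ⊢N)
          (∷-≈ {M = B} id ≈-refl (≈-sym (→β⇒≈ t)))
  subject-reduction (⊢conv ⊢M ⊢B A≈B) t = ⊢conv (subject-reduction ⊢M t) ⊢B A≈B

  ⊢-↠ : ∀ {n} {Γ : Ctx n} {M N A} → Γ ⊢ M ∶ A → M ↠ N → Γ ⊢ N ∶ A
  ⊢-↠ ⊢M ε        = ⊢M
  ⊢-↠ ⊢M (t ◅ ts) = ⊢-↠ (subject-reduction ⊢M t) ts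

  -- The conversion rule asks for a sort that types `B`, which a top sort lacks. When `B` is a sort,
  -- either `A` is typed and reduces to `B`, so that subject reduction types `B`, or `A` is a sort
  -- and equals `B`.
  ⊢-≈ : ∀ {n} {Γ : Ctx n} {M A B} → Γ ⊢ M ∶ A → A ≈ B → IsType Γ B → Γ ⊢ M ∶ B
  ⊢-≈ ⊢M A≈B (_ , inj₁ (_ , ⊢B)) = ⊢conv ⊢M ⊢B A≈B
  ⊢-≈ ⊢M A≈s (_ , inj₂ (_ , refl)) with type-correctness ⊢M
  ... | _ , inj₁ (_ , ⊢A)   = ⊢conv ⊢M (⊢-↠ ⊢A (≈sort A≈s)) A≈s
  ... | _ , inj₂ (_ , refl) with sort-injective A≈s
  ... | refl = ⊢M

-- The Kripke logical relation: codes, elements and coherence.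

module LogicalRelation (S : Spec) (s₀ : Spec.Sort S) where
  open λS S
  open SyntaxProperties Sort Const
  open BetaReduction S
  open PTSMetatheory S

  -- The readings of Type and Kind: any two distinct closed normal terms would do, as long as
  -- they are not products and no λS type converts to them.
  ⌜_⌝ : ∀ {n} → λΠ-Sort → Term n
  ⌜ Type ⌝ = ƛ (sort s₀) (sort s₀)
  ⌜ Kind ⌝ = ƛ (sort s₀) (ƛ (sort s₀) (sort s₀))

  ⌜⌝-/ : ∀ {m n} {σ : Sub Term m n} i → ⌜ i ⌝ / σ ≡ ⌜ i ⌝
  ⌜⌝-/ Type = refl
  ⌜⌝-/ Kind = refl

  ⌜⌝-normal : ∀ {n} {M : Term n} i → ¬ ⌜ i ⌝ →β M
  ⌜⌝-normal Type (step ())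
  ⌜⌝-normal Type (ƛˡ (step ()))
  ⌜⌝-normal Type (ƛʳ (step ()))
  ⌜⌝-normal Kind (step ())
  ⌜⌝-normal Kind (ƛˡ (step ()))
  ⌜⌝-normal Kind (ƛʳ (step ()))
  ⌜⌝-normal Kind (ƛʳ (ƛˡ (step ())))
  ⌜⌝-normal Kind (ƛʳ (ƛʳ (step ())))

  ≈⌜⌝ : ∀ {n} {M : Term n} i → M ≈ ⌜ i ⌝ → M ↠ ⌜ i ⌝
  ≈⌜⌝ i p with church-rosser p
  ... | _ , m , ε     = m
  ... | _ , m , r ◅ _ = ⊥-elim (⌜⌝-normal i r)

  ⌜⌝-injective : ∀ {n} i j → ⌜_⌝ {n} i ≈ ⌜ j ⌝ → i ≡ j
  ⌜⌝-injective Type Type _ = refl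
  ⌜⌝-injective Kind Kind _ = refl
  ⌜⌝-injective Type Kind p with ≈⌜⌝ Kind p
  ... | r ◅ _ = ⊥-elim (⌜⌝-normal Type r)
  ⌜⌝-injective Kind Type p with ≈⌜⌝ Type p
  ... | r ◅ _ = ⊥-elim (⌜⌝-normal Kind r)

  ¬ƛ-Type : ∀ {n} {Δ : Ctx n} {A M s} → ¬ Δ ⊢ ƛ A M ∶ sort s
  ¬ƛ-Type ⊢M = let _ , _ , _ , _ , e = generation-ƛ ⊢M in sort≉Π (≈-sym e)

  -- `⌜ i ⌝` is a normal abstraction: a typed `T` would reduce to it and give it a sort as type,
  -- against generation, while a sort reduces only to itself.
  ⌜⌝≉IsType : ∀ {n} {Δ : Ctx n} {T} i → IsType Δ T → ¬ T ≈ ⌜ i ⌝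
  ⌜⌝≉IsType Type (_ , inj₁ (_ , ⊢T)) p = ¬ƛ-Type (⊢-↠ ⊢T (≈⌜⌝ Type p))
  ⌜⌝≉IsType Kind (_ , inj₁ (_ , ⊢T)) p = ¬ƛ-Type (⊢-↠ ⊢T (≈⌜⌝ Kind p))
  ⌜⌝≉IsType i (_ , inj₂ (_ , refl)) p with sort-↠ (≈⌜⌝ i p)
  ⌜⌝≉IsType Type (_ , inj₂ (_ , refl)) p | ()
  ⌜⌝≉IsType Kind (_ , inj₂ (_ , refl)) p | ()

  ⌜⌝≉Π : ∀ {n} {A : Term n} {B} i → ¬ Π A B ≈ ⌜ i ⌝
  ⌜⌝≉Π i p with Π-↠ (≈⌜⌝ i p)
  ⌜⌝≉Π Type p | _ , _ , () , _
  ⌜⌝≉Π Kind p | _ , _ , () , _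

  -- Replaces raw components by typed ones: a λS type that converts to a product reduces to one by
  -- confluence, and subject reduction types the result.
  IsType-Π : ∀ {n} {Δ : Ctx n} {T A B} → IsType Δ T → T ≈ Π A B →
             ∃[ A′ ] ∃[ B′ ] ∃[ s ] T ↠ Π A′ B′ × A ≈ A′ × B ≈ B′ × Δ ⊢ Π A′ B′ ∶ sort s
  IsType-Π (_ , inj₂ (_ , refl)) p = ⊥-elim (sort≉Π p)
  IsType-Π (_ , inj₁ (_ , ⊢T)) p =
    let _ , _ , r , a , b = ≈Π p in _ , _ , _ , r , a , b , ⊢-↠ ⊢T r

  -- Readings contain β-redexes, such as an applied `ε s`, that λS need not type, so typing is asked
  -- only of some convertible term.
  Inhabits : ∀ {n} → Ctx n → Term n → Term n → Set
  Inhabits Δ T M = ∃[ M′ ] M ≈ M′ × Δ ⊢ M′ ∶ T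

  Inhabits-≈ : ∀ {n} {Δ : Ctx n} {T T′ M M′} → T ≈ T′ → IsType Δ T′ → M ≈ M′ →
               Inhabits Δ T M → Inhabits Δ T′ M′
  Inhabits-≈ p t q (M₁ , e , ⊢M₁) = M₁ , ≈-trans (≈-sym q) e , ⊢-≈ ⊢M₁ p t

  Inhabits-/ : ∀ {m n} {Γ : Ctx m} {Δ : Ctx n} {σ T M} → Inhabits Γ T M → Δ ⊢ₛ σ ∶ Γ →
               Inhabits Δ (T / σ) (M / σ)
  Inhabits-/ (M₁ , e , ⊢M₁) σ⊢ = M₁ / _ , ≈-/ _ e , ⊢-/ ⊢M₁ σ⊢

  -- The second condition on elements of a product. The quantification over `σ` makes it stable
  -- under changes of world; it is vacuous if no instance of `T` converts to a term typed by a sort.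
  record InhabitsTypings {n} (Δ : Ctx n) (T M : Term n) : Set where
    constructor mk
    field
      at : ∀ {m} {Δ′ : Ctx m} {σ} → Δ′ ⊢ₛ σ ∶ Δ →
           ∀ {T′ s} → T / σ ≈ T′ → Δ′ ⊢ T′ ∶ sort s → Inhabits Δ′ T′ (M / σ)
  open InhabitsTypings

  InhabitsTypings-≈ : ∀ {n} {Δ : Ctx n} {T T′ M M′} → T ≈ T′ → M ≈ M′ →
                      InhabitsTypings Δ T M → InhabitsTypings Δ T′ M′
  InhabitsTypings-≈ p q h = mk λ σ⊢ e ⊢T →
    Inhabits-≈ ≈-refl (wf σ⊢ , inj₁ (_ , ⊢T)) (≈-/ _ q) (at h σ⊢ (≈-trans (≈-/ _ p) e) ⊢T)

  InhabitsTypings-/ : ∀ {m n} {Γ : Ctx m} {Δ : Ctx n} {σ T M} → InhabitsTypings Γ T M →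
                      Δ ⊢ₛ σ ∶ Γ → InhabitsTypings Δ (T / σ) (M / σ)
  InhabitsTypings-/ {T = T} {M} h σ⊢ = mk λ τ⊢ e ⊢T →
    Inhabits-≈ ≈-refl (wf τ⊢ , inj₁ (_ , ⊢T)) (≡⇒≈ (/-⊙ M))
      (at h (⊢ₛ-⊙ σ⊢ τ⊢) (≈-trans (≡⇒≈ (/-⊙ T)) e) ⊢T)

  -- Codes are defined over a layer so that the elements of a base code can themselves be codes of
  -- an earlier instance of `U`, instead of codes of the universe being defined.
  record Layer : Set₁ where
    field
      Has     : λΠ-Sort → Set
      Holds   : λΠ-Sort → ∀ {n} → Ctx n → Term n → Set
      Holds-≈ : ∀ i {n} {Δ : Ctx n} {M N} → M ≈ N → Holds i Δ M → Holds i Δ N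
      Holds-/ : ∀ i {m n} {Γ : Ctx m} {Δ : Ctx n} {σ M} → Δ ⊢ₛ σ ∶ Γ →
                Holds i Γ M → Holds i Δ (M / σ)
  open Layer

  -- A term may have both a small and a pi code; coherence shows that their elements agree.
  data U (X : Layer) {n} (Δ : Ctx n) (T : Term n) : Set
  El : ∀ {X n} {Δ : Ctx n} {T} → U X Δ T → Term n → Set

  data U X Δ T where
    small : ∀ {T′} → T ≈ T′ → IsType Δ T′ → U X Δ T
    base  : ∀ i → T ≈ ⌜ i ⌝ → Has X i → U X Δ T
    pi    : ∀ {A B} → T ≈ Π A B →
            (a : ∀ {m} {Δ′ : Ctx m} {σ} → Δ′ ⊢ₛ σ ∶ Δ → U X Δ′ (A / σ)) →
            (∀ {m} {Δ′ : Ctx m} {σ} (σ⊢ : Δ′ ⊢ₛ σ ∶ Δ) {N} → El (a σ⊢) N →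
             U X Δ′ (B / (N ∷ σ))) →
            U X Δ T

  El {Δ = Δ} (small {T′} _ _) M = Inhabits Δ T′ M
  El {X} {Δ = Δ} (base i _ _) M = Holds X i Δ M
  El {Δ = Δ} {T} (pi _ a b) M =
    (∀ {m} {Δ′ : Ctx m} {σ} (σ⊢ : Δ′ ⊢ₛ σ ∶ Δ) {N} (n : El (a σ⊢) N) →
     El (b σ⊢ n) ((M / σ) · N)) ×
    InhabitsTypings Δ T M

  El-≈ : ∀ {X n} {Δ : Ctx n} {T M M′} (p : U X Δ T) → M ≈ M′ → El p M → El p M′
  El-≈ (small _ t)      e x = Inhabits-≈ ≈-refl t e x
  El-≈ {X} (base i _ _) e x = Holds-≈ X i e x
  El-≈ (pi _ a b) e (f , h) =
    (λ σ⊢ n → El-≈ (b σ⊢ n) (≈-· (≈-/ _ e) ≈-refl) (f σ⊢ n)) , InhabitsTypings-≈ ≈-refl e h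

  -- For a `pi` code this is the second condition on its elements, taken at the identity
  -- substitution; for a `base` code the hypotheses are contradictory.
  small⇒ : ∀ {X n} {Δ : Ctx n} {T T′ M} (p : U X Δ T) → T ≈ T′ → IsType Δ T′ →
           El p M → Inhabits Δ T′ M
  -- Induction on the code. An argument `N` of a `pi` code may be untypable, but `small⇒` at the
  -- domain converts it to a typed `N₁`; the application to `N₁` is typed in λS and re-enters the
  -- codomain by induction.
  small⇐ : ∀ {X n} {Δ : Ctx n} {T T′ M} (p : U X Δ T) → T ≈ T′ → IsType Δ T′ →
           Inhabits Δ T′ M → El p M

  small⇒ (small e _) T≈T′ t x = Inhabits-≈ (≈-trans (≈-sym e) T≈T′) t ≈-refl x
  small⇒ (base i e _) T≈T′ t x = ⊥-elim (⌜⌝≉IsType i t (≈-trans (≈-sym T≈T′) e))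
  small⇒ {T = T} {M = M} (pi e a b) T≈T′ t (f , h) with IsType-Π t (≈-trans (≈-sym T≈T′) e)
  ... | _ , _ , _ , r , _ , _ , ⊢Π₁ =
    Inhabits-≈ (≈-sym (↠⇒≈ r)) t (≡⇒≈ (id-vanishes M))
      (at h (⊢ₛ-id (proj₁ t)) (≈-trans (≡⇒≈ (id-vanishes T)) (≈-trans T≈T′ (↠⇒≈ r))) ⊢Π₁)

  small⇐ (small e t) T≈T′ _ x = Inhabits-≈ (≈-trans (≈-sym T≈T′) e) t ≈-refl x
  small⇐ (base i e _) T≈T′ t x = ⊥-elim (⌜⌝≉IsType i t (≈-trans (≈-sym T≈T′) e))
  small⇐ {T = T} {T′} (pi {A} {B} e a b) T≈T′ t x@(M₁ , M≈M₁ , ⊢M₁)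
    with IsType-Π t (≈-trans (≈-sym T≈T′) e)
  ... | A₁ , B₁ , _ , r , A≈A₁ , B≈B₁ , ⊢Π₁ =
    (λ {_} {Δ′} {σ} σ⊢ {N} n →
      let N₁ , N≈N₁ , ⊢N₁ = small⇒ (a σ⊢) (≈-/ σ A≈A₁) (wf σ⊢ , inj₁ (_ , ⊢-/ ⊢A₁ σ⊢)) n
      in  small⇐ (b σ⊢ n) (∷-≈ σ B≈B₁ N≈N₁)
            (wf σ⊢ , inj₁ (_ , ⊢-/ ⊢B₁ (⊢ₛ-∷ σ⊢ ⊢N₁)))
            (_ , ≈-· (≈-/ σ M≈M₁) N≈N₁ ,
             ⊢-≡ refl (↑-/-sub B₁ σ N₁)
               (⊢· (⊢-≈ (⊢-/ ⊢M₁ σ⊢) (≈-/ σ (↠⇒≈ r)) (wf σ⊢ , inj₁ (_ , ⊢-/ ⊢Π₁ σ⊢))) ⊢N₁))) ,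
    mk (λ {_} {Δ′} {σ} σ⊢ e′ ⊢T →
      Inhabits-≈ (≈-trans (≈-/ σ (≈-sym T≈T′)) e′) (wf σ⊢ , inj₁ (_ , ⊢T)) ≈-refl
        (Inhabits-/ x σ⊢))
    where
    ⊢A₁ : _ ⊢ A₁ ∶ sort _
    ⊢A₁ = let _ , _ , _ , ⊢A₁ , _ = generation-Π ⊢Π₁ in ⊢A₁
    ⊢B₁ : _ ▹ A₁ ⊢ B₁ ∶ sort _
    ⊢B₁ = let _ , _ , _ , _ , ⊢B₁ , _ = generation-Π ⊢Π₁ in ⊢B₁

  Compatible : Layer → Layer → Set
  Compatible X Y = ∀ i → Has X i → Has Y i → ∀ {n} {Δ : Ctx n} {M} →
                   (Holds X i Δ M → Holds Y i Δ M) × (Holds Y i Δ M → Holds X i Δ M)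

  -- A `small` code on either side is settled by `small⇒` and `small⇐`; otherwise confluence forces
  -- equal shapes. The domain of a product is contravariant, so both directions are proved at once.
  -- Two layers are allowed in order to cover both irrelevance of codes and inclusion of layers.
  coherence : ∀ {X Y} → Compatible X Y →
              ∀ {n} {Δ : Ctx n} {T T′} (p : U X Δ T) (q : U Y Δ T′) → T ≈ T′ → ∀ {M} →
              (El p M → El q M) × (El q M → El p M)
  coherence c (small e t) q T≈T′ =
    (λ x → small⇐ q (≈-trans (≈-sym T≈T′) e) t x) , (λ x → small⇒ q (≈-trans (≈-sym T≈T′) e) t x)
  coherence c p@(base _ _ _) (small e t) T≈T′ =
    small⇒ p (≈-trans T≈T′ e) t , small⇐ p (≈-trans T≈T′ e) t
  coherence c p@(pi _ _ _) (small e t) T≈T′ =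
    small⇒ p (≈-trans T≈T′ e) t , small⇐ p (≈-trans T≈T′ e) t
  coherence c (base i e x) (base j e′ y) T≈T′
    with ⌜⌝-injective i j (≈-trans (≈-sym e) (≈-trans T≈T′ e′))
  ... | refl = c i x y
  coherence c (base i e _) (pi e′ _ _) T≈T′ =
    ⊥-elim (⌜⌝≉Π i (≈-trans (≈-sym e′) (≈-trans (≈-sym T≈T′) e)))
  coherence c (pi e _ _) (base i e′ _) T≈T′ =
    ⊥-elim (⌜⌝≉Π i (≈-trans (≈-sym e) (≈-trans T≈T′ e′)))
  coherence c (pi e a b) (pi e′ a′ b′) T≈T′
    with Π-injective (≈-trans (≈-sym e) (≈-trans T≈T′ e′))
  ... | A≈A′ , B≈B′ =
    (λ (f , h) →
      (λ σ⊢ n′ → let n = proj₂ (coherence c (a σ⊢) (a′ σ⊢) (≈-/ _ A≈A′)) n′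
                 in  proj₁ (coherence c (b σ⊢ n) (b′ σ⊢ n′) (≈-/ _ B≈B′)) (f σ⊢ n)) ,
      InhabitsTypings-≈ T≈T′ ≈-refl h) ,
    (λ (f , h) →
      (λ σ⊢ n → let n′ = proj₁ (coherence c (a σ⊢) (a′ σ⊢) (≈-/ _ A≈A′)) n
                in  proj₂ (coherence c (b σ⊢ n) (b′ σ⊢ n′) (≈-/ _ B≈B′)) (f σ⊢ n′)) ,
      InhabitsTypings-≈ (≈-sym T≈T′) ≈-refl h)

  El-irrelevant : ∀ {X n} {Δ : Ctx n} {T T′} (p : U X Δ T) (q : U X Δ T′) → T ≈ T′ →
                  ∀ {M} → El p M → El q M
  El-irrelevant p q e = proj₁ (coherence (λ _ _ _ → (λ x → x) , (λ x → x)) p q e)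

  U-≈ : ∀ {X n} {Δ : Ctx n} {T T′} → T ≈ T′ → U X Δ T → U X Δ T′
  U-≈ e (small p t)  = small (≈-trans (≈-sym e) p) t
  U-≈ e (base i p x) = base i (≈-trans (≈-sym e) p) x
  U-≈ e (pi p a b)   = pi (≈-trans (≈-sym e) p) a b

  U-/ : ∀ {X m n} {Γ : Ctx m} {Δ : Ctx n} {σ T} → Δ ⊢ₛ σ ∶ Γ → U X Γ T → U X Δ (T / σ)
  U-/ σ⊢ (small e t)  = small (≈-/ _ e) (IsType-/ t σ⊢)
  U-/ σ⊢ (base i e x) = base i (≈-trans (≈-/ _ e) (≡⇒≈ (⌜⌝-/ i))) x
  U-/ {σ = σ} σ⊢ (pi {A} {B} e a b) = pi (≈-/ σ e)
    (λ τ⊢ → U-≈ (≡⇒≈ (/-⊙ A)) (a (⊢ₛ-⊙ σ⊢ τ⊢)))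
    (λ τ⊢ n → U-≈ (≡⇒≈ (sym (↑-/-∷ B σ _ _)))
      (b (⊢ₛ-⊙ σ⊢ τ⊢)
        (El-irrelevant (U-≈ (≡⇒≈ (/-⊙ A)) (a (⊢ₛ-⊙ σ⊢ τ⊢))) (a (⊢ₛ-⊙ σ⊢ τ⊢))
          (≡⇒≈ (sym (/-⊙ A))) n)))

  El-/ : ∀ {X m n} {Γ : Ctx m} {Δ : Ctx n} {σ T M} (σ⊢ : Δ ⊢ₛ σ ∶ Γ) (p : U X Γ T) →
         El p M → El (U-/ σ⊢ p) (M / σ)
  El-/ σ⊢ (small e t) x = Inhabits-/ x σ⊢
  El-/ {X} σ⊢ (base i e _) x = Holds-/ X i σ⊢ x
  El-/ {σ = σ} {M = M} σ⊢ (pi {A} {B} e a b) (f , h) =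
    (λ τ⊢ n →
      let q = a (⊢ₛ-⊙ σ⊢ τ⊢) ; d = ≡⇒≈ (/-⊙ A) ; d′ = ≡⇒≈ (sym (/-⊙ A))
          n′ = El-irrelevant (U-≈ d q) q d′ n
          r = b (⊢ₛ-⊙ σ⊢ τ⊢) n′ ; e′ = ≡⇒≈ (sym (↑-/-∷ B σ _ _))
      in  El-irrelevant r (U-≈ e′ r) e′
            (El-≈ r (≈-· (≡⇒≈ (/-⊙ M)) ≈-refl) (f (⊢ₛ-⊙ σ⊢ τ⊢) n′))) ,
    InhabitsTypings-/ h σ⊢

  -- Inclusion of base codes alone would not carry `pi` codes over: their codomains expect elements
  -- of the domain in `X`, to which elements in `Y` are moved back by `compatible`.
  record _≼_ (X Y : Layer) : Set where
    field
      Has-≼      : ∀ i → Has X i → Has Y i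
      compatible : Compatible X Y
  open _≼_

  U-≼ : ∀ {X Y n} {Δ : Ctx n} {T} → X ≼ Y → U X Δ T → U Y Δ T
  U-≼ l (small e t)  = small e t
  U-≼ l (base i e x) = base i e (Has-≼ l i x)
  U-≼ l (pi e a b)   = pi e (λ σ⊢ → U-≼ l (a σ⊢))
    (λ σ⊢ n → U-≼ l (b σ⊢ (proj₂ (coherence (compatible l) (a σ⊢) (U-≼ l (a σ⊢)) ≈-refl) n)))

  El-≼ : ∀ {X Y n} {Δ : Ctx n} {T M} (l : X ≼ Y) (p : U X Δ T) → El p M → El (U-≼ l p) M
  El-≼ l p = proj₁ (coherence (compatible l) p (U-≼ l p) ≈-refl)

  infix 4 _∋_⊩_∶_

  _∋_⊩_∶_ : Layer → ∀ {n} → Ctx n → Term n → Term n → Set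
  X ∋ Δ ⊩ M ∶ T = Σ (U X Δ T) λ p → El p M

  ⊩-≈ : ∀ {X n} {Δ : Ctx n} {T T′ M M′} → M ≈ M′ → T ≈ T′ → X ∋ Δ ⊩ M ∶ T → X ∋ Δ ⊩ M′ ∶ T′
  ⊩-≈ e e′ (p , x) = U-≈ e′ p , El-≈ (U-≈ e′ p) e (El-irrelevant p (U-≈ e′ p) e′ x)

  ⊩-/ : ∀ {X m n} {Γ : Ctx m} {Δ : Ctx n} {σ T M} → Δ ⊢ₛ σ ∶ Γ →
        X ∋ Γ ⊩ M ∶ T → X ∋ Δ ⊩ M / σ ∶ T / σ
  ⊩-/ σ⊢ (p , x) = U-/ σ⊢ p , El-/ σ⊢ p x

  ⊩-≼ : ∀ {X Y n} {Δ : Ctx n} {T M} → X ≼ Y → X ∋ Δ ⊩ M ∶ T → Y ∋ Δ ⊩ M ∶ T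
  ⊩-≼ l (p , x) = U-≼ l p , El-≼ l p x

  ⊩-small : ∀ {X n} {Δ : Ctx n} {T T′ M} → T ≈ T′ → IsType Δ T′ → Inhabits Δ T′ M → X ∋ Δ ⊩ M ∶ T
  ⊩-small e t x = small e t , x

  ↑≡∷⊙wk : ∀ {m n} {σ : Sub Term m n} → σ ↑ ≡ var zero ∷ (σ ⊙ wk)
  ↑≡∷⊙wk = cong (var zero ∷_) map-weaken

  -- The variable is an element of a `small` code made from its λS type `weaken A′`, so no code for
  -- `A / σ` has to be known beforehand.
  ⊩-var : ∀ {X m n} {Δ : Ctx n} {σ : Sub Term m n} {A A′} →
          WF (Δ ▹ A′) → A / σ ≈ A′ → X ∋ Δ ▹ A′ ⊩ var zero ∶ A / (σ ⊙ wk)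
  ⊩-var {Δ = Δ} {A = A} {A′} wf′ e = ⊩-small
    (≈-trans (≡⇒≈ (/-⊙ A)) (≈-trans (≈-/ wk e) (≡⇒≈ (/-wk A′))))
    (type-correctness ⊢0) (_ , ≈-refl , ⊢0)
    where
    ⊢0 : Δ ▹ A′ ⊢ var zero ∶ weaken A′
    ⊢0 = ⊢var zero wf′

-- Semantic typing and its rules.

module SemanticTyping (S : Spec) (s₀ : Spec.Sort S) where
  open λS S
  open SyntaxProperties Sort Const
  open BetaReduction S
  open PTSMetatheory S
  open LogicalRelation S s₀
  open Layer
  open InhabitsTypings

  ⊩Family : Layer → ∀ {n} → Ctx n → Term n → Term (suc n) → Term (suc n) → Set
  ⊩Family X Δ A B M =
    ∀ {m} {Δ′ : Ctx m} {σ} → Δ′ ⊢ₛ σ ∶ Δ → ∀ {N} → X ∋ Δ′ ⊩ N ∶ A / σ →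
    X ∋ Δ′ ⊩ M / (N ∷ σ) ∶ B / (N ∷ σ)

  -- If an instance of `Π A B` converts to a λS product `Π A₁ B₁`, a fresh variable of type `A₁` is
  -- an element of the domain. The body evaluated at it converts to a proof of `B₁`, and abstracting
  -- that proof over `A₁` gives the required term.
  InhabitsTypings-ƛ : ∀ {X n} {Δ : Ctx n} A B M → ⊩Family X Δ A B M →
                      InhabitsTypings Δ (Π A B) (ƛ A M)
  InhabitsTypings-ƛ {X} {Δ = Δ} A B M h = mk λ {_} {Δ′} {σ} σ⊢ {T′} e ⊢T →
    let t = wf σ⊢ , inj₁ (_ , ⊢T)
        A₁ , B₁ , _ , r , A≈A₁ , B≈B₁ , ⊢Π₁ = IsType-Π t (≈-sym e)
        _ , _ , _ , ⊢A₁ , ⊢B₁ , _ = generation-Π ⊢Π₁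
        wf′ = extend ⊢A₁
        q , y = h (⊢ₛ-⊙ σ⊢ (⊢ₛ-wk wf′)) (⊩-var {X} {σ = σ} {A} wf′ A≈A₁)
        M₁ , M≈M₁ , ⊢M₁ = small⇒ q
          (≈-trans (≡⇒≈ (cong (B /_) (sym (↑≡∷⊙wk {σ = σ})))) B≈B₁)
          (wf′ , inj₁ (_ , ⊢B₁)) y
    in  _ , ≈-ƛ A≈A₁ (≈-trans (≡⇒≈ (cong (M /_) (↑≡∷⊙wk {σ = σ}))) M≈M₁) ,
        ⊢-≈ (⊢ƛ ⊢M₁ ⊢Π₁) (≈-sym (↠⇒≈ r)) t

  ⊩-ƛ : ∀ {X n} {Δ : Ctx n} {A B M} → U X Δ (Π A B) → ⊩Family X Δ A B M →
        X ∋ Δ ⊩ ƛ A M ∶ Π A B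
  ⊩-ƛ {X} {Δ = Δ} {A} {B} {M} p h = p , go p
    where
    go : (p : U X Δ (Π A B)) → El p (ƛ A M)
    go (small e (_ , inj₂ (_ , refl))) = ⊥-elim (sort≉Π (≈-sym e))
    go (small e t@(wf , inj₁ (_ , ⊢T))) =
      Inhabits-≈ ≈-refl t (≡⇒≈ (id-vanishes (ƛ A M)))
        (at (InhabitsTypings-ƛ {X} A B M h) (⊢ₛ-id wf) (≈-trans (≡⇒≈ (id-vanishes (Π A B))) e) ⊢T)
    go (base i e _) = ⊥-elim (⌜⌝≉Π i e)
    go (pi e a b) =
      (λ {_} {_} {σ} σ⊢ {N} n →
        let A≈A′ , B≈B′ = Π-injective e
            q , y = h σ⊢ (⊩-≈ ≈-refl (≈-/ σ (≈-sym A≈A′)) (a σ⊢ , n))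
        -- Elements are closed under conversion, so the contractum supplied by `h` is expanded to
        -- the β-redex.
        in  El-≈ (b σ⊢ n)
              (≈-trans (≡⇒≈ (sym (↑-/-sub M σ N))) (≈-sym (→β⇒≈ (step β))))
              (El-irrelevant q (b σ⊢ n) (≈-/ _ B≈B′) y)) ,
      InhabitsTypings-ƛ {X} A B M h

  ⊩-· : ∀ {X n} {Δ : Ctx n} {A B M N} → WF Δ → X ∋ Δ ⊩ M ∶ Π A B → X ∋ Δ ⊩ N ∶ A →
        X ∋ Δ ⊩ M · N ∶ B [ N ]
  ⊩-· wf (small e t , M₁ , M≈M₁ , ⊢M₁) (q , y) =
    let A₁ , B₁ , _ , r , A≈A₁ , B≈B₁ , ⊢Π₁ = IsType-Π t (≈-sym e)
        _ , _ , _ , ⊢A₁ , ⊢B₁ , _ = generation-Π ⊢Π₁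
        N₁ , N≈N₁ , ⊢N₁ = small⇒ q A≈A₁ (wf , inj₁ (_ , ⊢A₁)) y
    in  ⊩-small (∷-≈ id B≈B₁ N≈N₁) (wf , inj₁ (_ , ⊢-[] ⊢B₁ ⊢N₁))
          (_ , ≈-· M≈M₁ N≈N₁ , ⊢· (⊢-≈ ⊢M₁ (↠⇒≈ r) (wf , inj₁ (_ , ⊢Π₁))) ⊢N₁)
  ⊩-· wf (base i e _ , _) _ = ⊥-elim (⌜⌝≉Π i e)
  ⊩-· {M = M} wf (pi {A′} e a b , f , _) (q , y) =
    let A≈A′ , B≈B′ = Π-injective e
        n = El-irrelevant q (a (⊢ₛ-id wf)) (≈-trans A≈A′ (≡⇒≈ (sym (id-vanishes A′)))) y
    in  ⊩-≈ (≈-· (≡⇒≈ (id-vanishes M)) ≈-refl) (≈-/ _ (≈-sym B≈B′))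
          (b (⊢ₛ-id wf) n , f (⊢ₛ-id wf) n)

  -- Elements of Type are codes without base types, elements of Kind are codes over Type, and every
  -- λΠ/S type, Type and Kind included, has a code in the layer All.

  Types Kinds All : Layer

  Types = record
    { Has = λ _ → ⊥ ; Holds = λ _ _ _ → ⊥ ; Holds-≈ = λ _ _ () ; Holds-/ = λ _ _ () }

  Kinds = record
    { Has     = λ { Type → ⊤ ; Kind → ⊥ }
    ; Holds   = λ _ → U Types
    ; Holds-≈ = λ _ → U-≈
    ; Holds-/ = λ _ → U-/
    }

  layer : λΠ-Sort → Layer
  layer Type = Types
  layer Kind = Kinds

  All = record
    { Has     = λ _ → ⊤
    ; Holds   = λ i → U (layer i)
    ; Holds-≈ = λ _ → U-≈
    ; Holds-/ = λ _ → U-/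
    }

  Types≼ : ∀ {X} → Types ≼ X
  Types≼ = record { Has-≼ = λ _ () ; compatible = λ _ () }

  Kinds≼All : Kinds ≼ All
  Kinds≼All = record
    { Has-≼      = λ _ _ → tt
    ; compatible = λ { Type _ _ → (λ x → x) , (λ x → x) ; Kind () }
    }

  layer≼All : ∀ i → layer i ≼ All
  layer≼All Type = Types≼
  layer≼All Kind = Kinds≼All

  Types≼layer : ∀ i → Types ≼ layer i
  Types≼layer i = Types≼

  infix 4 _⊩ₛ_∶_ _⊨_∶_

  data _⊩ₛ_∶_ {m} (Δ : Ctx m) : ∀ {n} → Sub Term n m → Ctx n → Set where
    []  : Δ ⊩ₛ [] ∶ ∙
    _∷_ : ∀ {n} {Γ : Ctx n} {ρ A N} → All ∋ Δ ⊩ N ∶ A / ρ → Δ ⊩ₛ ρ ∶ Γ → Δ ⊩ₛ N ∷ ρ ∶ Γ ▹ A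

  ⊩ₛ-/ : ∀ {k m n} {Γ : Ctx n} {Δ : Ctx m} {Δ′ : Ctx k} {ρ σ} → Δ′ ⊢ₛ σ ∶ Δ → Δ ⊩ₛ ρ ∶ Γ →
         Δ′ ⊩ₛ ρ ⊙ σ ∶ Γ
  ⊩ₛ-/ σ⊢ []              = []
  ⊩ₛ-/ σ⊢ (_∷_ {A = A} v ρ⊩) = ⊩-≈ ≈-refl (≡⇒≈ (sym (/-⊙ A))) (⊩-/ σ⊢ v) ∷ ⊩ₛ-/ σ⊢ ρ⊩

  -- Γ is the reading of a λΠ/S context, hence only a list of raw λS terms.
  record _⊨_∶_ {n} (Γ : Ctx n) (M A : Term n) : Set where
    constructor mk
    field at : ∀ {m} {Δ : Ctx m} {ρ} → WF Δ → Δ ⊩ₛ ρ ∶ Γ → All ∋ Δ ⊩ M / ρ ∶ A / ρ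
  open _⊨_∶_ public using () renaming (at to ⟦_⟧)

  -- The code supplied for `⌜ i ⌝` is arbitrary; coherence exchanges it for `base i`, whose elements
  -- in `All` are the codes over `layer i`.
  ⊨-decode : ∀ {n} {Γ : Ctx n} {A} i → Γ ⊨ A ∶ ⌜ i ⌝ →
             ∀ {m} {Δ : Ctx m} {ρ} → WF Δ → Δ ⊩ₛ ρ ∶ Γ → U (layer i) Δ (A / ρ)
  ⊨-decode i ⊨A wf ρ⊩ =
    let p , x = ⟦ ⊨A ⟧ wf ρ⊩ in El-irrelevant p (base i ≈-refl tt) (≡⇒≈ (⌜⌝-/ i)) x

  ⊨-code : ∀ {n} {Γ : Ctx n} {A} i →
           (∀ {m} {Δ : Ctx m} {ρ} → WF Δ → Δ ⊩ₛ ρ ∶ Γ → U (layer i) Δ (A / ρ)) → Γ ⊨ A ∶ ⌜ i ⌝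
  ⊨-code i h = mk λ wf ρ⊩ → base i (≡⇒≈ (⌜⌝-/ i)) tt , h wf ρ⊩

  ⊨-var : ∀ {n} {Γ : Ctx n} x → Γ ⊨ var x ∶ typeOf Γ x
  ⊨-var x = mk λ _ → go x
    where
    go : ∀ {n} {Γ : Ctx n} x {m} {Δ : Ctx m} {ρ} → Δ ⊩ₛ ρ ∶ Γ →
         All ∋ Δ ⊩ lookup ρ x ∶ typeOf Γ x / ρ
    go {Γ = Γ ▹ A} zero (v ∷ ρ⊩) = ⊩-≈ ≈-refl (≡⇒≈ (sym (weaken-∷ A))) v
    go {Γ = Γ ▹ A} (suc x) (v ∷ ρ⊩) =
      ⊩-≈ ≈-refl (≡⇒≈ (sym (weaken-∷ (typeOf Γ x)))) (go x ρ⊩)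

  ⊨-conv : ∀ {n} {Γ : Ctx n} {M A B} → Γ ⊨ M ∶ A → A ≈ B → Γ ⊨ M ∶ B
  ⊨-conv ⊨M e = mk λ wf ρ⊩ → ⊩-≈ ≈-refl (≈-/ _ e) (⟦ ⊨M ⟧ wf ρ⊩)

  ⊨-Type : ∀ {n} {Γ : Ctx n} → Γ ⊨ ⌜ Type ⌝ ∶ ⌜ Kind ⌝
  ⊨-Type = ⊨-code Kind λ _ _ → base Type ≈-refl tt

  ⊨-Π : ∀ {n} {Γ : Ctx n} {A B} i → Γ ⊨ A ∶ ⌜ Type ⌝ → Γ ▹ A ⊨ B ∶ ⌜ i ⌝ → Γ ⊨ Π A B ∶ ⌜ i ⌝
  ⊨-Π {A = A} {B} i ⊨A ⊨B = ⊨-code i λ {_} {_} {ρ} wfΔ ρ⊩ →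
    let p = ⊨-decode Type ⊨A wfΔ ρ⊩ in
    pi ≈-refl (λ σ⊢ → U-/ σ⊢ (U-≼ (Types≼layer i) p))
      (λ {_} {_} {σ} σ⊢ {N} n → U-≈ (≡⇒≈ (sym (↑-/-∷ B ρ σ N)))
        (⊨-decode i ⊨B (wf σ⊢)
          -- The argument is an element in `layer i`; environments hold elements in `All`, to which
          -- it is raised.
          (⊩-≈ ≈-refl (≡⇒≈ (sym (/-⊙ A)))
            (⊩-≼ (layer≼All i) (U-/ σ⊢ (U-≼ (Types≼layer i) p) , n)) ∷ ⊩ₛ-/ σ⊢ ρ⊩)))

  ⊨-ƛ : ∀ {n} {Γ : Ctx n} {A B M} i → Γ ▹ A ⊨ M ∶ B → Γ ⊨ Π A B ∶ ⌜ i ⌝ → Γ ⊨ ƛ A M ∶ Π A B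
  ⊨-ƛ {A = A} {B} {M} i ⊨M ⊨Π = mk λ {_} {_} {ρ} wfΔ ρ⊩ →
    ⊩-ƛ (U-≼ (layer≼All i) (⊨-decode i ⊨Π wfΔ ρ⊩)) λ {_} {_} {σ} σ⊢ {N} v →
      ⊩-≈ (≡⇒≈ (sym (↑-/-∷ M ρ σ N))) (≡⇒≈ (sym (↑-/-∷ B ρ σ N)))
        (⟦ ⊨M ⟧ (wf σ⊢) (⊩-≈ ≈-refl (≡⇒≈ (sym (/-⊙ A))) v ∷ ⊩ₛ-/ σ⊢ ρ⊩))

  ⊨-· : ∀ {n} {Γ : Ctx n} {A B M N} → Γ ⊨ M ∶ Π A B → Γ ⊨ N ∶ A → Γ ⊨ M · N ∶ B [ N ]
  ⊨-· {B = B} {N = N} ⊨M ⊨N = mk λ wfΔ ρ⊩ →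
    ⊩-≈ ≈-refl (≡⇒≈ (sym (sub-commutes {t′ = N} B))) (⊩-· wfΔ (⟦ ⊨M ⟧ wfΔ ρ⊩) (⟦ ⊨N ⟧ wfΔ ρ⊩))

  ⊨-sort : ∀ {n} {Γ : Ctx n} s → Γ ⊨ sort s ∶ ⌜ Type ⌝
  ⊨-sort s = ⊨-code Type λ wf _ → small ≈-refl (wf , inj₂ (s , refl))

  -- The semantic content of `ε s`: an element of `sort s` converts to a term that λS types by `s`,
  -- and so has a `small` code.
  ⊨-El : ∀ {n} {Γ : Ctx n} {A s} → Γ ⊨ A ∶ sort s → Γ ⊨ A ∶ ⌜ Type ⌝
  ⊨-El ⊨A = ⊨-code Type λ wf ρ⊩ →
    let p , x = ⟦ ⊨A ⟧ wf ρ⊩ ; _ , e , ⊢A = small⇒ p ≈-refl (wf , inj₂ (_ , refl)) x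
    in  small e (wf , inj₁ (_ , ⊢A))

  ⊨-axiom : ∀ {n} {Γ : Ctx n} {s₁ s₂} → Axiom s₁ s₂ → Γ ⊨ sort s₁ ∶ sort s₂
  ⊨-axiom a = mk λ wf _ → ⊩-small ≈-refl (wf , inj₂ (_ , refl)) (_ , ≈-refl , ⊢sort wf a)

  -- `A` converts to a λS type `A₁`. Evaluating `B` at a fresh variable of type `A₁` gives a typed
  -- `B₁`, and the rule of `S` applies to these typed terms.
  ⊨-rule : ∀ {n} {Γ : Ctx n} {A B s₁ s₂ s₃} → Rule s₁ s₂ s₃ →
           Γ ⊨ A ∶ sort s₁ → Γ ▹ A ⊨ B ∶ sort s₂ → Γ ⊨ Π A B ∶ sort s₃
  ⊨-rule {A = A} {B} r ⊨A ⊨B = mk λ {_} {_} {ρ} wf ρ⊩ →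
    let p , x = ⟦ ⊨A ⟧ wf ρ⊩
        A₁ , A≈A₁ , ⊢A₁ = small⇒ p ≈-refl (wf , inj₂ (_ , refl)) x
        wf′ = extend ⊢A₁
        q , y = ⟦ ⊨B ⟧ wf′ (⊩-var {σ = ρ} {A} wf′ A≈A₁ ∷ ⊩ₛ-/ (⊢ₛ-wk wf′) ρ⊩)
        B₁ , B≈B₁ , ⊢B₁ = small⇒ q ≈-refl (wf′ , inj₂ (_ , refl)) y
    in  ⊩-small ≈-refl (wf , inj₂ (_ , refl))
          (_ , ≈-Π A≈A₁ (≈-trans (≡⇒≈ (cong (B /_) (↑≡∷⊙wk {σ = ρ}))) B≈B₁) , ⊢Π ⊢A₁ ⊢B₁ r)

  ⊩ₛ-id-▹ : ∀ {n} {Γ Γ′ : Ctx n} {A A′} → WF (Γ ▹ A) → A′ ≈ A → Γ ⊩ₛ id ∶ Γ′ →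
            Γ ▹ A ⊩ₛ id ∶ Γ′ ▹ A′
  ⊩ₛ-id-▹ {Γ = Γ} {Γ′} {A} {A′} wf′ e id⊩ =
    subst (λ ρ → Γ ▹ A ⊩ₛ var zero ∷ ρ ∶ Γ′ ▹ A′) id-⊙
      (⊩-var {σ = id} {A′} wf′ (≈-trans (≡⇒≈ (id-vanishes A′)) e) ∷ ⊩ₛ-/ (⊢ₛ-wk wf′) id⊩)

-- The reading of λΠ/S in λS, and conservativity.

module Reading (S : Spec) (s₀ : Spec.Sort S) where
  open λS S
  open Translation S
  open SyntaxProperties Sort Const
  open BetaReduction S
  open PTSMetatheory S
  open LogicalRelation S s₀
  open SemanticTyping S s₀
  private
    module P  = λΠ/S S
    module PS = SyntaxProperties λΠ-Sort P.Const
  open P using (u; ε; dot; pi)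

  ⟪_⟫ᶜ : ∀ {n} → P.Const → Term n
  ⟪ u s ⟫ᶜ        = sort s
  ⟪ ε s ⟫ᶜ        = ƛ (sort s) (var zero)
  ⟪ dot s ⟫ᶜ      = sort s
  ⟪ pi s₁ s₂ _ ⟫ᶜ =
    ƛ (sort s₁) (ƛ (Π (⟪ ε s₁ ⟫ᶜ · var zero) (sort s₂))
      -- The first `var (suc zero)` is the domain code; the second, under one more binder, is the
      -- family.
      (Π (var (suc zero)) (var (suc zero) · var zero)))

  ⟪_⟫ : ∀ {n} → P.Term n → Term n
  ⟪ P.sort i ⟫  = ⌜ i ⌝
  ⟪ P.var x ⟫   = var x
  ⟪ P.const c ⟫ = ⟪ c ⟫ᶜ
  ⟪ M P.· N ⟫   = ⟪ M ⟫ · ⟪ N ⟫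
  ⟪ P.ƛ A M ⟫   = ƛ ⟪ A ⟫ ⟪ M ⟫
  ⟪ P.Π A B ⟫   = Π ⟪ A ⟫ ⟪ B ⟫

  ⟪⟫-/Var : ∀ {m n} (M : P.Term m) (ρ : Sub Fin m n) → ⟪ M PS./Var ρ ⟫ ≡ ⟪ M ⟫ /Var ρ
  ⟪⟫-/Var (P.sort Type) ρ         = refl
  ⟪⟫-/Var (P.sort Kind) ρ         = refl
  ⟪⟫-/Var (P.var x) ρ             = refl
  ⟪⟫-/Var (P.const (u _)) ρ       = refl
  ⟪⟫-/Var (P.const (ε _)) ρ       = refl
  ⟪⟫-/Var (P.const (dot _)) ρ     = refl
  ⟪⟫-/Var (P.const (pi _ _ _)) ρ  = refl
  ⟪⟫-/Var (M P.· N) ρ             = cong₂ _·_ (⟪⟫-/Var M ρ) (⟪⟫-/Var N ρ)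
  ⟪⟫-/Var (P.ƛ A M) ρ             = cong₂ ƛ (⟪⟫-/Var A ρ) (⟪⟫-/Var M _)
  ⟪⟫-/Var (P.Π A B) ρ             = cong₂ Π (⟪⟫-/Var A ρ) (⟪⟫-/Var B _)

  ⟪⟫-weaken : ∀ {n} (M : P.Term n) → ⟪ P.weaken M ⟫ ≡ weaken ⟪ M ⟫
  ⟪⟫-weaken M = ⟪⟫-/Var M VarSubst.wk

  ⟪⟫-↑ : ∀ {m n} (σ : Sub P.Term m n) → map ⟪_⟫ (σ PS.↑) ≡ map ⟪_⟫ σ ↑
  ⟪⟫-↑ σ = cong (var zero ∷_)
    (trans (sym (Vec.map-∘ ⟪_⟫ P.weaken σ)) (trans (Vec.map-cong ⟪⟫-weaken σ)
      (Vec.map-∘ weaken ⟪_⟫ σ)))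

  ⟪⟫-/ : ∀ {m n} (M : P.Term m) (σ : Sub P.Term m n) → ⟪ M P./ σ ⟫ ≡ ⟪ M ⟫ / map ⟪_⟫ σ
  ⟪⟫-/ (P.sort i) σ             = sym (⌜⌝-/ i)
  ⟪⟫-/ (P.var x) σ              = sym (Vec.lookup-map x ⟪_⟫ σ)
  ⟪⟫-/ (P.const (u _)) σ        = refl
  ⟪⟫-/ (P.const (ε _)) σ        = refl
  ⟪⟫-/ (P.const (dot _)) σ      = refl
  ⟪⟫-/ (P.const (pi _ _ _)) σ   = refl
  ⟪⟫-/ (M P.· N) σ              = cong₂ _·_ (⟪⟫-/ M σ) (⟪⟫-/ N σ)
  ⟪⟫-/ (P.ƛ A M) σ              =
    cong₂ ƛ (⟪⟫-/ A σ) (trans (⟪⟫-/ M _) (cong (⟪ M ⟫ /_) (⟪⟫-↑ σ)))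
  ⟪⟫-/ (P.Π A B) σ              =
    cong₂ Π (⟪⟫-/ A σ) (trans (⟪⟫-/ B _) (cong (⟪ B ⟫ /_) (⟪⟫-↑ σ)))

  ⟪⟫-id : ∀ {n} → map ⟪_⟫ (PS.id {n}) ≡ id
  ⟪⟫-id {zero}  = refl
  ⟪⟫-id {suc n} = trans (⟪⟫-↑ PS.id) (cong _↑ ⟪⟫-id)

  ⟪⟫-[] : ∀ {n} (M : P.Term (suc n)) N → ⟪ M P.[ N ] ⟫ ≡ ⟪ M ⟫ [ ⟪ N ⟫ ]
  ⟪⟫-[] M N = trans (⟪⟫-/ M (P.sub N)) (cong (λ σ → ⟪ M ⟫ / (⟪ N ⟫ ∷ σ)) ⟪⟫-id)

  ε-β : ∀ {n} s (A : Term n) → ⟪ ε s ⟫ᶜ · A ≈ A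
  ε-β s A = →β⇒≈ (step β)

  pi-β : ∀ {n} s₁ s₂ s₃ (A B : Term n) →
         ⟪ pi s₁ s₂ s₃ ⟫ᶜ · A · B ≈ Π A (weaken B · var zero)
  pi-β _ _ _ A B = ≈-trans (→β⇒≈ (·ˡ (step β)))
    (≈-trans (→β⇒≈ (step β)) (≈-Π (≡⇒≈ (weaken-sub A)) ≈-refl))

  -- Removes the application that `pi-β` leaves in the codomain. The translation always passes an
  -- explicit abstraction to `pi`, so β does this without η.
  ƛ-weaken-β : ∀ {n} (A : Term n) M → weaken (ƛ A M) · var zero ≈ M
  ƛ-weaken-β A M = ≈-trans (≡⇒≈ (cong (_· var zero) (sym (/-wk (ƛ A M)))))
    (≈-trans (→β⇒≈ (step β)) (≡⇒≈ (trans (↑-/-sub M wk (var zero)) (id-vanishes M))))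

  βStep⇒≈ : ∀ {n} {M N : P.Term n} → P.βStep M N → ⟪ M ⟫ ≈ ⟪ N ⟫
  βStep⇒≈ (P.β {A} {M} {N}) = ≈-trans (→β⇒≈ (step β)) (≡⇒≈ (sym (⟪⟫-[] M N)))

  -- Both rewrite rules become β-conversions: `ε` is read as an identity function, and `pi` unfolds
  -- to the product it encodes.
  RStep⇒≈ : ∀ {n} {M N : P.Term n} → P.RStep M N → ⟪ M ⟫ ≈ ⟪ N ⟫
  RStep⇒≈ (P.rewrite-by (Encoding.ε-dot a) []) = ε-β _ _
  RStep⇒≈ (P.rewrite-by (Encoding.ε-pi {s₃ = s₃} r) (B ∷ A ∷ [])) =
    ≈-trans (ε-β _ _) (≈-trans (pi-β _ _ s₃ ⟪ A ⟫ ⟪ B ⟫)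
      (≈-Π (≈-sym (ε-β _ _))
        (≈-trans (≈-· (≡⇒≈ (sym (⟪⟫-weaken B))) ≈-refl) (≈-sym (ε-β _ _)))))

  contextual⇒≈ : {Step : ∀ {n} → Rel (P.Term n) 0ℓ} →
                 (∀ {n} {M N : P.Term n} → Step M N → ⟪ M ⟫ ≈ ⟪ N ⟫) →
                 ∀ {n} {M N : P.Term n} → P.Contextual Step M N → ⟪ M ⟫ ≈ ⟪ N ⟫
  contextual⇒≈ h (P.step r) = h r
  contextual⇒≈ h (P.·ˡ r)   = ≈-· (contextual⇒≈ h r) ≈-refl
  contextual⇒≈ h (P.·ʳ r)   = ≈-· ≈-refl (contextual⇒≈ h r)
  contextual⇒≈ h (P.ƛˡ r)   = ≈-ƛ (contextual⇒≈ h r) ≈-refl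
  contextual⇒≈ h (P.ƛʳ r)   = ≈-ƛ ≈-refl (contextual⇒≈ h r)
  contextual⇒≈ h (P.Πˡ r)   = ≈-Π (contextual⇒≈ h r) ≈-refl
  contextual⇒≈ h (P.Πʳ r)   = ≈-Π ≈-refl (contextual⇒≈ h r)

  ⟪⟫-≈ : ∀ {n} {M N : P.Term n} → M P.≈ N → ⟪ M ⟫ ≈ ⟪ N ⟫
  ⟪⟫-≈ = Eq.gfold (Eq.isEquivalence _⟶_) ⟪_⟫ λ where
    (inj₁ r) → contextual⇒≈ βStep⇒≈ r
    (inj₂ r) → contextual⇒≈ RStep⇒≈ r

  ⟪_⟫ˣ : ∀ {n} → P.Ctx n → Ctx n
  ⟪ P.∙ ⟫ˣ     = ∙
  ⟪ Γ P.▹ A ⟫ˣ = ⟪ Γ ⟫ˣ ▹ ⟪ A ⟫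

  ⟪⟫-typeOf : ∀ {n} (Γ : P.Ctx n) x → ⟪ P.typeOf Γ x ⟫ ≡ typeOf ⟪ Γ ⟫ˣ x
  ⟪⟫-typeOf (Γ P.▹ A) zero    = ⟪⟫-weaken A
  ⟪⟫-typeOf (Γ P.▹ A) (suc x) =
    trans (⟪⟫-weaken (P.typeOf Γ x)) (cong weaken (⟪⟫-typeOf Γ x))

  ⊨-ε : ∀ {n} {Γ : Ctx n} s → Γ ⊨ ⟪ ε s ⟫ᶜ ∶ Π (sort s) ⌜ Type ⌝
  -- The codomain is `Type` itself, so the arrow is an element of `Kind`, while `⊨-El` makes the
  -- bound variable an element of `Type`.
  ⊨-ε s = ⊨-ƛ Kind (⊨-El (⊨-var zero)) (⊨-Π Kind (⊨-sort s) ⊨-Type)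

  ⊨-pi : ∀ {n} {Γ : Ctx n} {s₁ s₂ s₃} → Rule s₁ s₂ s₃ →
         Γ ⊨ ⟪ pi s₁ s₂ s₃ ⟫ᶜ ∶
           Π (sort s₁) (Π (Π (⟪ ε s₁ ⟫ᶜ · var zero) (sort s₂)) (sort s₃))
  ⊨-pi {Γ = Γ} {s₁} {s₂} {s₃} r = ⊨-ƛ Type (⊨-ƛ Type (⊨-rule r (⊨-var (suc zero))
      (⊨-· (⊨-var (suc zero)) (⊨-conv (⊨-var zero) (≈-sym (ε-β _ _))))) ⊨T)
      (⊨-Π Type (⊨-sort s₁) ⊨T)
    where
    ⊨T : Γ ▹ sort s₁ ⊨ Π (Π (⟪ ε s₁ ⟫ᶜ · var zero) (sort s₂)) (sort s₃) ∶ ⌜ Type ⌝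
    ⊨T = ⊨-Π Type (⊨-Π Type (⊨-· (⊨-ε s₁) (⊨-var zero)) (⊨-sort s₂)) (⊨-sort s₃)

  -- Induction on the λΠ/S derivation. Conversion is sound because readings of βR-convertible types
  -- are β-convertible and semantic typing is closed under β-conversion.
  fundamental : ∀ {n} {Γ : P.Ctx n} {M A} → Γ P.⊢ M ∶ A → ⟪ Γ ⟫ˣ ⊨ ⟪ M ⟫ ∶ ⟪ A ⟫
  fundamental {Γ = Γ} (P.⊢var x _)           =
    ⊨-conv (⊨-var x) (≡⇒≈ (sym (⟪⟫-typeOf Γ x)))
  fundamental (P.⊢const _ (Encoding.u s))    = ⊨-sort s
  fundamental (P.⊢const _ (Encoding.ε s))    = ⊨-ε s
  fundamental (P.⊢const _ (Encoding.dot a))  = ⊨-axiom a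
  fundamental (P.⊢const _ (Encoding.pi r))   = ⊨-pi r
  fundamental (P.⊢sort _ Type∶Kind)          = ⊨-Type
  fundamental (P.⊢Π ⊢A ⊢B Type,Type)         = ⊨-Π Type (fundamental ⊢A) (fundamental ⊢B)
  fundamental (P.⊢Π ⊢A ⊢B Type,Kind)         = ⊨-Π Kind (fundamental ⊢A) (fundamental ⊢B)
  fundamental (P.⊢ƛ {s = i} ⊢M ⊢ΠAB)         = ⊨-ƛ i (fundamental ⊢M) (fundamental ⊢ΠAB)
  fundamental (P.⊢· {B = B} {N = N} ⊢M ⊢N)   =
    ⊨-conv (⊨-· (fundamental ⊢M) (fundamental ⊢N)) (≡⇒≈ (sym (⟪⟫-[] B N)))
  fundamental (P.⊢conv ⊢M _ A≈B)             = ⊨-conv (fundamental ⊢M) (⟪⟫-≈ A≈B)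

  mutual
    ∣∣≈ : ∀ {n} {Γ : Ctx n} {M M′} → Γ ⊢∣ M ∣≔ M′ → ⟪ M′ ⟫ ≈ M
    ∣∣≈ (sort s)  = ≈-refl
    ∣∣≈ (var x)   = ≈-refl
    ∣∣≈ (app m n) = ≈-· (∣∣≈ m) (∣∣≈ n)
    ∣∣≈ (ƛ a m)   = ≈-ƛ (‖‖≈ a) (∣∣≈ m)
    ∣∣≈ (Π {s₃ = s₃} {A₁ = A₁} {A₂} {B₁} _ _ _ a _ b) =
      ≈-trans (pi-β _ _ s₃ ⟪ A₁ ⟫ ⟪ P.ƛ A₂ B₁ ⟫)
        (≈-Π (∣∣≈ a) (≈-trans (ƛ-weaken-β ⟪ A₂ ⟫ ⟪ B₁ ⟫) (∣∣≈ b)))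

    ‖‖≈ : ∀ {n} {Γ : Ctx n} {A A′} → Γ ⊢‖ A ‖≔ A′ → ⟪ A′ ⟫ ≈ A
    ‖‖≈ (sort s)      = ≈-refl
    ‖‖≈ (Π a b)       = ≈-Π (‖‖≈ a) (‖‖≈ b)
    ‖‖≈ (other _ _ a) = ≈-trans (ε-β _ _) (∣∣≈ a)

  -- Each type in `Γ` is a λS type to which the reading of its translation converts, so every
  -- variable is an element of a `small` code.
  ‖‖⊩id : ∀ {n} {Γ : Ctx n} {Γ′} → WF Γ → ‖ Γ ‖≔ Γ′ → Γ ⊩ₛ id ∶ ⟪ Γ′ ⟫ˣ
  ‖‖⊩id _               empty        = []
  ‖‖⊩id wf@(extend ⊢A) (extend γ a) = ⊩ₛ-id-▹ wf (‖‖≈ a) (‖‖⊩id (typed⇒WF ⊢A) γ)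

  conservativity : ∀ {n} {Γ : Ctx n} {A Γ′ A′ N} → WF Γ → IsType Γ A →
                   ‖ Γ ‖≔ Γ′ → Γ ⊢‖ A ‖≔ A′ → Γ′ P.⊢ N ∶ A′ → ∃[ M ] Γ ⊢ M ∶ A
  conservativity wf t γ a ⊢N =
    let p , x = ⟦ fundamental ⊢N ⟧ wf (‖‖⊩id wf γ)
        -- Evaluation may produce any code for the reading of `A′`; since that reading converts to
        -- the λS type `A`, the element converts to a proof of `A`.
        M , _ , ⊢M = small⇒ p (≈-trans (≡⇒≈ (id-vanishes _)) (‖‖≈ a)) t x
    in  M , ⊢M

theorem5p24 : (S : Spec) → Functional S →
    let open λS S
        open Translation S
        module P = λΠ/S S
    in
    ∀ {n} (Γ : Ctx n) (A : Term n) → WF Γ → IsType Γ A →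
    ∀ (Γ′ : P.Ctx n) (A′ : P.Term n) → ‖ Γ ‖≔ Γ′ → Γ ⊢‖ A ‖≔ A′ →
    (∃[ N ] (Γ′ P.⊢ N ∶ A′)) →
    (∃[ M ] (Γ ⊢ M ∶ A))
-- The readings of `Type` and `Kind` are built from some sort; the one found in `IsType Γ A` serves.
theorem5p24 S _ _ _ wf t@(_ , inj₁ (s , _)) _ _ γ a (_ , ⊢N) =
  Reading.conservativity S s wf t γ a ⊢N
theorem5p24 S _ _ _ wf t@(_ , inj₂ (s , _)) _ _ γ a (_ , ⊢N) =
  Reading.conservativity S s wf t γ a ⊢N
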